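{- Let $n=2k+1$ with $k$ a positive integer, and let $(\Gamma,+)$ be an abelian group of order $n$ with neutral element $e$ such that $\sum_{g\in\Gamma} g = e$ and $2g\neq e$ for all $g\in\Gamma\setminus\{e\}$. Let $p,q$ be two new symbols and let $P_n=(\Gamma\times(\Gamma\setminus\{e\}))\cup\{p,q\}$. Define the lines $L_g=\{(h,g): h\in\Gamma\}$ for $g\in\Gamma\setminus\{e\}$; $l_{p_g}=\{(g,h): h\in\Gamma\setminus\{e\}\}\cup\{p\}$ for $g\in\Gamma$; $l_{q_g}=\{(h,h+g): h\in\Gamma,\ h+g\neq e\}\cup\{q\}$ for $g\in\Gamma$; and let $\mathcal{L}_n$ be the family of all these lines. Then the linear system $\mathcal{C}_{n,n+1}=(P_n,\mathcal{L}_n)$ satisfies $$\tau(\mathcal{C}_{n,n+1})=\nu_2(\mathcal{C}_{n,n+1})=n+1,$$ and it has the smallest possible number of lines for this property, in the following sense: $p$ and $q$ are points of largest and second largest degree (both equal to $n$) and $|\mathcal{L}_n|=3n-1=\deg(p)+\deg(q)+\nu_2(\mathcal{C}_{n,n+1})-2$, whereas every linear system $(P,\mathcal{L})$ with $|\mathcal{L}|>\nu_2(P,\mathcal{L})$ and $|\mathcal{L}|\le \deg(p')+\deg(q')+\nu_2(P,\mathcal{L})-3$, where $\deg(p')=\Delta(P,\mathcal{L})$ and $\deg(q')=\max\{\deg(x):x\in P\setminus\{p'\}\}$, satisfies $\tau(P,\mathcal{L})\le\nu_2(P,\mathcal{L})-1$.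
   Context: A linear system is a pair $(P,\mathcal{L})$ with $P$ a finite set of points and $\mathcal{L}$ a family of subsets of $P$ (lines) such that any two distinct lines share at most one point. A transversal is a set of points meeting every line; $\tau$ is the minimum cardinality of a transversal. A 2-packing is a set of lines no three of which have a common point; $\nu_2$ is the maximum cardinality of a 2-packing. $\deg(x)$ is the number of lines containing $x$ and $\Delta$ is the maximum degree. -}

module Defs where

open import Level using (Level; _⊔_) renaming (suc to lsuc)
open import Algebra.Bundles using (AbelianGroup)
open import Data.List.Base using (List; length; filter; foldr)
open import Data.List.Relation.Unary.Any using (Any)
import Data.List.Membership.Setoid as Membership
import Data.List.Relation.Unary.Enumerates.Setoid as Enumerates
import Data.List.Relation.Unary.Unique.Setoid as Unique
open import Data.Nat.Base using (ℕ; _≤_)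
open import Data.Product.Base using (∃-syntax; Σ-syntax; _×_; _,_; proj₁)
open import Data.Product.Relation.Binary.Pointwise.NonDependent using (_×ₛ_)
open import Data.Sum.Base using (_⊎_; inj₁; inj₂)
open import Data.Sum.Relation.Binary.Pointwise using (_⊎ₛ_)
open import Relation.Binary.Bundles using (Setoid)
import Relation.Binary.Construct.On as On
open import Relation.Binary.Definitions using (_Respects_)
open import Relation.Binary.PropositionalEquality using (_≡_)
import Relation.Binary.PropositionalEquality as ≡
open import Relation.Nullary.Decidable.Core using (Dec)
open import Relation.Nullary.Negation.Core using (¬_)
open import Relation.Unary using (Pred; _∈_)
open import Relation.Unary.Relation.Binary.Equality using (≐-setoid)

private
  variable
    a b i r c ℓ : Level

record Finite (S : Setoid a b) : Set (a ⊔ b) where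
  open Setoid S using (Carrier)
  field
    elements : List Carrier
    unique   : Unique.Unique S elements
    complete : Enumerates.IsEnumeration S elements

  size : ℕ
  size = length elements

-- The family is given by an index type Line, but two indices denote the same
-- line exactly when their subsets have the same points (setoid Lines), so
-- repetitions in the indexing are never counted.
record SetSystem a b i r : Set (lsuc (a ⊔ b ⊔ i ⊔ r)) where
  field
    Points : Setoid a b

  open Setoid Points public
    renaming (Carrier to Point; _≈_ to _≈ₚ_; _≉_ to _≉ₚ_)
    using ()

  field
    Line : Set i
    ⟦_⟧  : Line → Pred Point r

  Lines : Setoid i (a ⊔ r)
  Lines = On.setoid (≐-setoid Point r) ⟦_⟧

  open Setoid Lines public
    renaming (_≈_ to _≈ₗ_; _≉_ to _≉ₗ_)
    using ()

record IsLinearSystem (S : SetSystem a b i r) : Set (a ⊔ b ⊔ i ⊔ r) where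
  open SetSystem S
  field
    finitePoints : Finite Points
    finiteLines  : Finite Lines
    respects     : ∀ l → ⟦ l ⟧ Respects _≈ₚ_
    _∈?_         : ∀ x l → Dec (x ∈ ⟦ l ⟧)
    linear       : ∀ l m → l ≉ₗ m → ∀ x y →
                   x ∈ ⟦ l ⟧ → x ∈ ⟦ m ⟧ → y ∈ ⟦ l ⟧ → y ∈ ⟦ m ⟧ → x ≈ₚ y

record LinearSystem a b i r : Set (lsuc (a ⊔ b ⊔ i ⊔ r)) where
  constructor mkLinearSystem
  field
    setSystem      : SetSystem a b i r
    isLinearSystem : IsLinearSystem setSystem

  open SetSystem setSystem public
  open IsLinearSystem isLinearSystem public

  ∣ℒ∣ : ℕ
  ∣ℒ∣ = Finite.size finiteLines

  deg : Point → ℕ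
  deg x = length (filter (x ∈?_) (Finite.elements finiteLines))

  HasMaxDegree : Point → Set a
  HasMaxDegree x = ∀ y → deg y ≤ deg x

  HasMaxDegreeApartFrom : Point → Point → Set (a ⊔ b)
  HasMaxDegreeApartFrom x y = y ≉ₚ x × (∀ z → z ≉ₚ x → deg z ≤ deg y)

  IsTransversal : List Point → Set (i ⊔ a ⊔ r)
  IsTransversal T = ∀ l → Any (_∈ ⟦ l ⟧) T

  Is2Packing : List Line → Set (a ⊔ i ⊔ r)
  Is2Packing R = ∀ l m n → l ∈ₗ R → m ∈ₗ R → n ∈ₗ R →
                 l ≉ₗ m → m ≉ₗ n → l ≉ₗ n →
                 ¬ (∃[ x ] x ∈ ⟦ l ⟧ × x ∈ ⟦ m ⟧ × x ∈ ⟦ n ⟧)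
    where open Membership Lines renaming (_∈_ to _∈ₗ_)

  -- "τ = t". If some line is empty there is no transversal, and no t
  -- satisfies this.
  IsTransversalNumber : ℕ → Set (a ⊔ b ⊔ i ⊔ r)
  IsTransversalNumber t =
    (∃[ T ] Unique.Unique Points T × IsTransversal T × length T ≡ t) ×
    (∀ T → Unique.Unique Points T → IsTransversal T → t ≤ length T)

  -- "ν₂ = ν".
  Is2PackingNumber : ℕ → Set (a ⊔ i ⊔ r)
  Is2PackingNumber ν =
    (∃[ R ] Unique.Unique Lines R × Is2Packing R × length R ≡ ν) ×
    (∀ R → Unique.Unique Lines R → Is2Packing R → length R ≤ ν)

-- The abelian group is written additively in the comments and
-- multiplicatively (_∙_, ε) in the code, as in the library's bundle.
module _ (Γ : AbelianGroup c ℓ) where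
  open AbelianGroup Γ

  ∑ : List Carrier → Carrier
  ∑ = foldr _∙_ ε

  NonNeutral : Setoid (c ⊔ ℓ) ℓ
  NonNeutral = On.setoid {B = Σ[ g ∈ Carrier ] g ≉ ε} setoid proj₁

  data Symbol : Set where
    p q : Symbol

  CPoints : Setoid (c ⊔ ℓ) (c ⊔ ℓ)
  CPoints = (setoid ×ₛ NonNeutral) ⊎ₛ ≡.setoid Symbol

  open Setoid CPoints using () renaming (Carrier to CPoint; _≈_ to _≈ₚ_)

  data CLine : Set (c ⊔ ℓ) where
    L  : (g : Carrier) → g ≉ ε → CLine
    lp : Carrier → CLine
    lq : Carrier → CLine

  C⟦_⟧ : CLine → Pred CPoint (c ⊔ ℓ)
  C⟦ L g g≉ε ⟧ x = ∃[ h ] x ≈ₚ inj₁ (h , g , g≉ε)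
  C⟦ lp g    ⟧ x = (∃[ h ] Σ[ h≉ε ∈ h ≉ ε ] x ≈ₚ inj₁ (g , h , h≉ε))
                   ⊎ x ≈ₚ inj₂ p
  C⟦ lq g    ⟧ x = (∃[ h ] Σ[ h+g≉ε ∈ h ∙ g ≉ ε ] x ≈ₚ inj₁ (h , h ∙ g , h+g≉ε))
                   ⊎ x ≈ₚ inj₂ q

  -- 𝒞_{n,n+1}, where n is the order of Γ.
  𝒞 : SetSystem (c ⊔ ℓ) (c ⊔ ℓ) (c ⊔ ℓ) (c ⊔ ℓ)
  𝒞 = record { Points = CPoints ; Line = CLine ; ⟦_⟧ = C⟦_⟧ }

{-# OPTIONS --safe #-}
module Submission where

open import Defs
open import Algebra.Bundles using (AbelianGroup; Group)
import Algebra.Properties.AbelianGroup as AbelianGroupₚ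
import Algebra.Properties.CommutativeSemigroup as CommutativeSemigroupₚ
import Algebra.Properties.Group as Groupₚ
import Data.Empty as Empty
open import Data.Empty.Polymorphic using (⊥)
open import Data.List.Base using (List; []; _∷_; _++_; map; filter; length; cartesianProduct; deduplicate)
import Data.List.Membership.Setoid as Membership
import Data.List.Membership.Setoid.Properties as Membershipₚ
open Membershipₚ using (∈-∃++; ∈-filter⁺; ∈-filter⁻; ∈-map⁺; ∈-map⁻; ∈-++⁺ˡ; ∈-++⁺ʳ)
open import Data.List.Properties using (length-map; length-++; length-deduplicate; ++-identityʳ)
import Data.List.Relation.Binary.Permutation.Propositional as Perm≡
import Data.List.Relation.Binary.Permutation.Propositional.Properties as Perm≡ₚ
import Data.List.Relation.Binary.Permutation.Setoid as Permutation
import Data.List.Relation.Binary.Permutation.Setoid.Properties as Permutationₚ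
open import Data.List.Relation.Unary.All as All using (All; []; _∷_; all?)
open import Data.List.Relation.Unary.All.Properties as All using (All¬⇒¬Any; ¬Any⇒All¬; all-filter)
open import Data.List.Relation.Unary.AllPairs using ([]; _∷_)
open import Data.List.Relation.Unary.Any as Any using (Any; here; there; any?; satisfied)
import Data.List.Relation.Unary.Any.Properties as Any
import Data.List.Relation.Unary.Enumerates.Setoid.Properties as Enumerates
import Data.List.Relation.Unary.Unique.DecSetoid.Properties as UniqueDec
import Data.List.Relation.Unary.Unique.Setoid as Unique
import Data.List.Relation.Unary.Unique.Setoid.Properties as Unique
open import Data.Nat.Base using (ℕ; suc; _+_; _*_; _≤_; _<_; z≤n; s≤s)
open import Data.Nat.Properties hiding (_≟_)
open import Data.Product.Base using (∃; ∃-syntax; Σ-syntax; _×_; _,_; proj₁; proj₂)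
open import Data.Product.Relation.Binary.Pointwise.NonDependent using (_×ₛ_)
open import Data.Sum.Base using (_⊎_; inj₁; inj₂)
open import Data.Sum.Relation.Binary.Pointwise using (_⊎ₛ_; inj₁; inj₂; drop-inj₁; drop-inj₂)
open import Data.Unit.Polymorphic using (⊤; tt)
open import Function.Base using (_∘_)
open import Level using (Level)
open import Relation.Binary.Bundles using (Setoid; DecSetoid)
import Relation.Binary.Construct.On as On
import Relation.Binary.Definitions as Binary
open import Relation.Binary.Definitions using (_Respects_)
open import Relation.Binary.PropositionalEquality using (_≡_; refl; cong; cong₂; subst; module ≡-Reasoning)
import Relation.Binary.PropositionalEquality as ≡
open import Relation.Nullary.Decidable using (Dec; yes; no; ¬?; _×-dec_; map′)
open import Relation.Nullary.Negation using (¬_; contradiction)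
open import Relation.Unary using (Pred; Decidable; _∈_; _∉_)

-- 𝒞_{n,n+1}. A transversal with n points avoids p and q, hence meets every l_{p_g} and every
-- l_{q_g} exactly once: the first coordinates x and the differences y − x each run through Γ,
-- so the second coordinates y sum to e. But they run through Γ∖{e}, whose sum is e, with one
-- element repeated. For 2-packings: a packing has at most two lines through each of p and q,
-- and each intersection l_{p_a} ∩ l_{q_b} excludes the line L_{a+b}; as 2g ≠ e for g ≠ e, two
-- and two lines have at least three different sums a+b, which pays for the extra lines.
--
-- General systems. Let M be the set of lines missing both p and q, so τ ≤ |M| + 2. The bound on |ℒ|
-- gives |M| + 3 ≤ ν₂, unless p and q lie on a common line l and |M| + 2 = ν₂. If then
-- τ > |M| + 1, the lines of M are pairwise disjoint. Some line lₚ ∋ p misses q. Choose a point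
-- on every m ∈ M, on lₚ if m meets lₚ; these points and p miss some line l′, and M together
-- with l, lₚ and l′ is a 2-packing, so |M| + 3 ≤ ν₂ after all.

private
  variable
    a b c d i r ℓ : Level

-- Duplicate-free lists and finite setoids.

module _ (S : Setoid a b) where
  open Setoid S renaming (refl to ≈-refl)
  open Membership S using () renaming (_∈_ to _∈ₛ_)
  open Permutation S using (_↭_; ↭-refl; ↭-trans; ↭-prep; ↭-reflexive; ↭-reflexive-≋)

  -- Each element of `xs` is located in `ys` and moved to the front; as `xs` has no repetitions, its
  -- other elements survive in the rest. The leftover `zs` is kept, and not only its length, because
  -- the transversal bound needs its sum.
  unique∧⊆⇒↭-++ : ∀ {xs ys} → Unique.Unique S xs → (∀ {x} → x ∈ₛ xs → x ∈ₛ ys) →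
                  ∃[ zs ] ys ↭ xs ++ zs
  unique∧⊆⇒↭-++ {[]}     {ys} _ _ = ys , ↭-refl
  unique∧⊆⇒↭-++ {x ∷ xs} {ys} (x∉xs ∷ xs!) xs⊆ys
    with as , bs , w , x≈w , ys≋ ← ∈-∃++ S (xs⊆ys (here ≈-refl)) = zs , ys↭x∷xs++zs
    where
    ys↭ : ys ↭ x ∷ as ++ bs
    ys↭ = ↭-trans (↭-reflexive-≋ ys≋) (Permutationₚ.shift S (sym x≈w) as bs)

    xs⊆ : ∀ {y} → y ∈ₛ xs → y ∈ₛ as ++ bs
    xs⊆ y∈xs with Permutationₚ.∈-resp-↭ S ys↭ (xs⊆ys (there y∈xs))
    ... | here y≈x   = contradiction (Any.map (trans (sym y≈x)) y∈xs) (All¬⇒¬Any x∉xs)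
    ... | there y∈   = y∈

    rec = unique∧⊆⇒↭-++ xs! xs⊆
    zs  = proj₁ rec

    ys↭x∷xs++zs : ys ↭ x ∷ xs ++ zs
    ys↭x∷xs++zs = ↭-trans ys↭ (↭-prep x (proj₂ rec))

  unique∧⊆⇒length-≤ : ∀ {xs ys} → Unique.Unique S xs → (∀ {x} → x ∈ₛ xs → x ∈ₛ ys) →
                      length xs ≤ length ys
  unique∧⊆⇒length-≤ {xs} {ys} xs! xs⊆ys with zs , ys↭ ← unique∧⊆⇒↭-++ xs! xs⊆ys = begin
    length xs               ≤⟨ m≤m+n _ _ ⟩
    length xs + length zs   ≡⟨ length-++ xs ⟨
    length (xs ++ zs)       ≡⟨ Permutationₚ.xs↭ys⇒|xs|≡|ys| S ys↭ ⟨
    length ys               ∎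
    where open ≤-Reasoning

  -- Two elements are equal exactly when they sit at the same position of the duplicate-free
  -- enumeration, and positions can be compared.
  Finite⇒≟ : Finite S → Binary.Decidable _≈_
  Finite⇒≟ fin x y = compare (Finite.unique fin) (Finite.complete fin x) (Finite.complete fin y)
    where
    ≉-tail : ∀ {x y z zs} → All (z ≉_) zs → x ≈ z → y ∈ₛ zs → ¬ x ≈ y
    ≉-tail z∉zs x≈z y∈zs x≈y =
      All¬⇒¬Any z∉zs (Any.map (trans (trans (sym x≈z) x≈y)) y∈zs)

    compare : ∀ {x y zs} → Unique.Unique S zs → x ∈ₛ zs → y ∈ₛ zs → Dec (x ≈ y)
    compare _          (here x≈z)   (here y≈z)   = yes (trans x≈z (sym y≈z))
    compare (z∉zs ∷ _) (here x≈z)   (there y∈zs) = no (≉-tail z∉zs x≈z y∈zs)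
    compare (z∉zs ∷ _) (there x∈zs) (here y≈z)   = no (≉-tail z∉zs y≈z x∈zs ∘ sym)
    compare (_ ∷ zs!)  (there x∈zs) (there y∈zs) = compare zs! x∈zs y∈zs

  Finite⇒∃? : Finite S → ∀ {ℓ} {P : Pred Carrier ℓ} → P Respects _≈_ → Decidable P → Dec (∃ P)
  Finite⇒∃? fin resp P? =
    map′ satisfied (λ (x , px) → Any.map (λ x≈y → resp x≈y px) (Finite.complete fin x))
         (any? P? (Finite.elements fin))

  2≤size⇒∃≉ : (fin : Finite S) → 2 ≤ Finite.size fin → ∀ e → ∃[ x ] ¬ x ≈ e
  2≤size⇒∃≉ fin 2≤ e = choose (Finite.elements fin) (Finite.unique fin) 2≤
    where
    choose : ∀ xs → Unique.Unique S xs → 2 ≤ length xs → ∃[ x ] ¬ x ≈ e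
    choose (_ ∷ [])    _                 (s≤s ())
    choose (x ∷ y ∷ _) ((x≉y ∷ _) ∷ _) _ with Finite⇒≟ fin x e
    ... | no  x≉e = x , x≉e
    ... | yes x≈e = y , λ y≈e → x≉y (trans x≈e (sym y≈e))

  -- Pigeonhole: the length bound leaves no room for a leftover.
  unique∧⊆∧length-≥⇒↭ : ∀ {xs ys} → Unique.Unique S xs → (∀ {x} → x ∈ₛ xs → x ∈ₛ ys) →
                        length ys ≤ length xs → ys ↭ xs
  unique∧⊆∧length-≥⇒↭ {xs} {ys} xs! xs⊆ys ∣ys∣≤∣xs∣ with unique∧⊆⇒↭-++ xs! xs⊆ys
  ... | []     , ys↭ = ↭-trans ys↭ (↭-reflexive (++-identityʳ xs))
  ... | z ∷ zs , ys↭ = contradiction ∣ys∣≤∣xs∣ (<⇒≱ (begin-strict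
    length xs                       <⟨ m<m+n (length xs) (s≤s z≤n) ⟩
    length xs + length (z ∷ zs)     ≡⟨ length-++ xs ⟨
    length (xs ++ z ∷ zs)           ≡⟨ Permutationₚ.xs↭ys⇒|xs|≡|ys| S ys↭ ⟨
    length ys                       ∎))
    where open ≤-Reasoning

  length≡size : (fin : Finite S) → ∀ {xs} → Unique.Unique S xs → (∀ x → x ∈ₛ xs) →
                length xs ≡ Finite.size fin
  length≡size fin xs! xs-complete = ≤-antisym
    (unique∧⊆⇒length-≤ xs! (λ {x} _ → Finite.complete fin x))
    (unique∧⊆⇒length-≤ (Finite.unique fin) (λ {x} _ → xs-complete x))

  Unique-++⁻ : ∀ xs {ys} → Unique.Unique S (xs ++ ys) → Unique.Unique S xs × Unique.Unique S ys
  Unique-++⁻ []       ys!          = [] , ys!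
  Unique-++⁻ (x ∷ xs) (x∉ ∷ xsys!) with xs! , ys! ← Unique-++⁻ xs xsys! = All.++⁻ˡ xs x∉ ∷ xs! , ys!

-- Counting with filters and splitting lists.

module _ {A : Set a} {P : Pred A ℓ} (P? : Decidable P) where

  length-filter-¬ : ∀ xs → length (filter P? xs) + length (filter (¬? ∘ P?) xs) ≡ length xs
  length-filter-¬ [] = refl
  length-filter-¬ (x ∷ xs) with P? x
  ... | yes _ = cong suc (length-filter-¬ xs)
  ... | no  _ = ≡.trans (+-suc _ _) (cong suc (length-filter-¬ xs))

  module _ {q} {Q : Pred A q} (Q? : Decidable Q) where

    private
      both?    = λ x → P? x ×-dec Q? x
      neither? = λ x → ¬? (P? x) ×-dec ¬? (Q? x)

    inclusion-exclusion : ∀ xs →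
      length xs + length (filter both? xs) ≡
      length (filter P? xs) + length (filter Q? xs) + length (filter neither? xs)
    inclusion-exclusion [] = refl
    inclusion-exclusion (x ∷ xs) with P? x | Q? x | inclusion-exclusion xs
    ... | yes _ | yes _ | ih = cong suc (≡.trans (+-suc (length xs) _)
      (≡.trans (cong suc ih) (cong (_+ length (filter neither? xs)) (≡.sym (+-suc (length (filter P? xs)) _)))))
    ... | yes _ | no  _ | ih = cong suc ih
    ... | no  _ | yes _ | ih = ≡.trans (cong suc ih)
      (cong (_+ length (filter neither? xs)) (≡.sym (+-suc (length (filter P? xs)) _)))
    ... | no  _ | no  _ | ih = ≡.trans (cong suc ih)
      (≡.sym (+-suc (length (filter P? xs) + length (filter Q? xs)) _))

module _ {A : Set a} {B : Set b} where
  open Perm≡ using (_↭_; ↭-refl; ↭-prep; ↭-trans; ↭-sym)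

  partition-⊎ : (zs : List (A ⊎ B)) → ∃[ xs ] ∃[ ys ] zs ↭ map inj₁ xs ++ map inj₂ ys
  partition-⊎ [] = [] , [] , ↭-refl
  partition-⊎ (inj₁ x ∷ zs) with xs , ys , zs↭ ← partition-⊎ zs = x ∷ xs , ys , ↭-prep _ zs↭
  partition-⊎ (inj₂ y ∷ zs) with xs , ys , zs↭ ← partition-⊎ zs =
    xs , y ∷ ys , ↭-trans (↭-prep _ zs↭) (↭-sym (Perm≡ₚ.shift _ (map inj₁ xs) (map inj₂ ys)))

-- Finiteness of images, products, sums and subsets.

module _ (S : Setoid a b) (T : Setoid c d) where
  private
    module S = Setoid S
    module T = Setoid T

  Finite-map : (f : S.Carrier → T.Carrier) → (∀ {x y} → x S.≈ y → f x T.≈ f y) →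
               (∀ {x y} → f x T.≈ f y → x S.≈ y) → (∀ y → ∃[ x ] f x T.≈ y) →
               Finite S → Finite T
  Finite-map f f-cong f-inj f-surj fin = record
    { elements = map f (Finite.elements fin)
    ; unique   = Unique.map⁺ S T f-inj (Finite.unique fin)
    ; complete = λ y → let x , fx≈y = f-surj y in
        Membershipₚ.∈-resp-≈ T fx≈y (∈-map⁺ S T f-cong (Finite.complete fin x))
    }

  Finite-× : Finite S → Finite T → Finite (S ×ₛ T)
  Finite-× finS finT = record
    { elements = cartesianProduct (Finite.elements finS) (Finite.elements finT)
    ; unique   = Unique.cartesianProduct⁺ S T (Finite.unique finS) (Finite.unique finT)
    ; complete = Enumerates.cartesianProduct⁺ S T (Finite.complete finS) (Finite.complete finT)
    }

  Finite-⊎ : Finite S → Finite T → Finite (S ⊎ₛ T)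
  Finite-⊎ finS finT = record
    { elements = map inj₁ (Finite.elements finS) ++ map inj₂ (Finite.elements finT)
    ; unique   = Unique.++⁺ (S ⊎ₛ T)
        (Unique.map⁺ S (S ⊎ₛ T) drop-inj₁ (Finite.unique finS))
        (Unique.map⁺ T (S ⊎ₛ T) drop-inj₂ (Finite.unique finT))
        disjoint
    ; complete = Enumerates.++⁺ S T (Finite.complete finS) (Finite.complete finT)
    }
    where
    open Membership (S ⊎ₛ T) using () renaming (_∈_ to _∈ₛ_)
    disjoint : ∀ {z xs ys} → ¬ (z ∈ₛ map inj₁ xs × z ∈ₛ map inj₂ ys)
    disjoint {inj₁ x} (_ , z∈ys) with _ , _ , () ← ∈-map⁻ T (S ⊎ₛ T) z∈ys
    disjoint {inj₂ y} (z∈xs , _) with _ , _ , () ← ∈-map⁻ S (S ⊎ₛ T) z∈xs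

  size-⊎ : (finS : Finite S) (finT : Finite T) →
           Finite.size (Finite-⊎ finS finT) ≡ Finite.size finS + Finite.size finT
  size-⊎ finS finT = ≡.trans (length-++ (map inj₁ (Finite.elements finS)))
    (cong₂ _+_ (length-map inj₁ (Finite.elements finS)) (length-map inj₂ (Finite.elements finT)))

module _ (S : Setoid a b) {P : Pred (Setoid.Carrier S) ℓ} (P? : Decidable P)
         (P-resp : P Respects Setoid._≈_ S) where

  private
    Subset : Setoid _ _
    Subset = On.setoid {B = ∃ P} S proj₁

    restrict : List (Setoid.Carrier S) → List (∃ P)
    restrict [] = []
    restrict (x ∷ xs) with P? x
    ... | yes px = (x , px) ∷ restrict xs
    ... | no  _  = restrict xs

    map-proj₁-restrict : ∀ xs → map proj₁ (restrict xs) ≡ filter P? xs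
    map-proj₁-restrict [] = refl
    map-proj₁-restrict (x ∷ xs) with P? x
    ... | yes _ = cong (x ∷_) (map-proj₁-restrict xs)
    ... | no  _ = map-proj₁-restrict xs

  Finite-∃ : Finite S → Finite Subset
  Finite-∃ fin = record
    { elements = restrict xs
    ; unique   = Unique.map⁻ Subset S (λ x≈y → x≈y)
        (subst (Unique.Unique S) (≡.sym (map-proj₁-restrict xs)) (Unique.filter⁺ S P? (Finite.unique fin)))
    ; complete = λ (x , px) → Any.map⁻ (subst (x ∈ₛ_) (≡.sym (map-proj₁-restrict xs))
        (∈-filter⁺ S P? P-resp (Finite.complete fin x) px))
    }
    where
    open Membership S using () renaming (_∈_ to _∈ₛ_)
    xs = Finite.elements fin

-- Transversals, 2-packings and degrees in a general linear system.

module _ (S : LinearSystem a b i r) where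
  open LinearSystem S
  open Membership Lines using () renaming (_∈_ to _∈ₗ_)

  private
    lines = Finite.elements finiteLines
    module P = Setoid Points
    module L = Setoid Lines

  ∋-resp-≈ₗ : ∀ x → (λ l → x ∈ ⟦ l ⟧) Respects _≈ₗ_
  ∋-resp-≈ₗ x (l⊆m , _) = l⊆m

  ∌-resp-≈ₗ : ∀ x → (λ l → x ∉ ⟦ l ⟧) Respects _≈ₗ_
  ∌-resp-≈ₗ x (_ , m⊆l) x∉l x∈m = x∉l (m⊆l x∈m)

  ∈∧∉⇒≉ₗ : ∀ {x l m} → x ∈ ⟦ l ⟧ → x ∉ ⟦ m ⟧ → l ≉ₗ m
  ∈∧∉⇒≉ₗ x∈l x∉m (l⊆m , _) = x∉m (l⊆m x∈l)

  -- The definition of τ minimises over duplicate-free lists only. Deduplication lets candidate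
  -- transversals be written down without checking that their points differ.
  transversal⇒τ≤length : ∀ {τ} → IsTransversalNumber τ → ∀ T → IsTransversal T → τ ≤ length T
  transversal⇒τ≤length (_ , minimal) T T-transversal = ≤-trans
    (minimal (deduplicate _≟_ T) (UniqueDec.deduplicate-! decPoints T)
      λ l → Any.deduplicate⁺ _≟_ (respects l ∘ P.sym) (T-transversal l))
    (length-deduplicate _≟_ T)
    where
    _≟_ = Finite⇒≟ Points finitePoints
    decPoints : DecSetoid _ _
    decPoints = record { isDecEquivalence = record { isEquivalence = P.isEquivalence ; _≟_ = _≟_ } }

  -- Minimality of τ with a witness: there are finitely many lines and being missed is decidable, so
  -- either a missed line is found or `T` is a transversal.
  short⇒misses : ∀ {τ} → IsTransversalNumber τ → ∀ T → length T < τ →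
                 ∃[ l ] All (λ x → x ∉ ⟦ l ⟧) T
  short⇒misses isτ T ∣T∣<τ
    with Finite⇒∃? Lines finiteLines {P = λ l → All (λ x → x ∉ ⟦ l ⟧) T}
           (λ l≈m → All.map (λ {x} → ∌-resp-≈ₗ x l≈m))
           (λ l → all? (λ x → ¬? (x ∈? l)) T)
  ... | yes missed = missed
  ... | no ¬missed = contradiction (transversal⇒τ≤length isτ T hits) (<⇒≱ ∣T∣<τ)
    where
    hits : IsTransversal T
    hits l with any? (_∈? l) T
    ... | yes hit = hit
    ... | no ¬hit = contradiction (l , ¬Any⇒All¬ T ¬hit) ¬missed

  representatives-hit : ∀ {f : Line → Point} → (∀ l → f l ∈ ⟦ l ⟧) →
                        ∀ {l ms} → l ∈ₗ ms → Any (_∈ ⟦ l ⟧) (map f ms)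
  representatives-hit f∈ l∈ms = Any.map⁺ (Any.map (λ {m} (_ , m⊆l) → m⊆l (f∈ m)) l∈ms)

  -- Three distinct lines of `R` through x would form a duplicate-free list of length three inside
  -- `F`. This turns the packing condition into a point-by-point listing of lines.
  twoThroughEachPoint⇒2Packing : ∀ {R} →
    (∀ x → ∃[ F ] length F ≤ 2 × (∀ {l} → l ∈ₗ R → x ∈ ⟦ l ⟧ → l ∈ₗ F)) → Is2Packing R
  twoThroughEachPoint⇒2Packing {R} through l m n l∈R m∈R n∈R l≉m m≉n l≉n (x , x∈l , x∈m , x∈n) =
    <⇒≱ (unique∧⊆⇒length-≤ Lines ((l≉m ∷ l≉n ∷ []) ∷ (m≉n ∷ []) ∷ [] ∷ []) ⊆F) ∣F∣≤2
    where
    F    = proj₁ (through x)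
    ∣F∣≤2 = proj₁ (proj₂ (through x))

    resp : ∀ {k k′} → k ≈ₗ k′ → k′ ∈ₗ R → x ∈ ⟦ k′ ⟧ → k ∈ₗ F
    resp {k} {k′} k≈k′ k′∈R x∈k′ =
      Membershipₚ.∈-resp-≈ Lines (L.sym {k} {k′} k≈k′) (proj₂ (proj₂ (through x)) k′∈R x∈k′)

    ⊆F : ∀ {k} → k ∈ₗ l ∷ m ∷ n ∷ [] → k ∈ₗ F
    ⊆F (here k≈l)                 = resp k≈l l∈R x∈l
    ⊆F (there (here k≈m))         = resp k≈m m∈R x∈m
    ⊆F (there (there (here k≈n))) = resp k≈n n∈R x∈n

  deg≤length : ∀ x F → (∀ l → x ∈ ⟦ l ⟧ → l ∈ₗ F) → deg x ≤ length F
  deg≤length x F ⊆F = unique∧⊆⇒length-≤ Lines (Unique.filter⁺ Lines (x ∈?_) (Finite.unique finiteLines))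
    λ {l} l∈ → ⊆F l (proj₂ (∈-filter⁻ Lines (x ∈?_) (∋-resp-≈ₗ x) {xs = Finite.elements finiteLines} l∈))

  length≤deg : ∀ x F → Unique.Unique Lines F → (∀ {l} → l ∈ₗ F → x ∈ ⟦ l ⟧) → length F ≤ deg x
  length≤deg x F F! F∋x = unique∧⊆⇒length-≤ Lines F!
    λ {l} l∈F → ∈-filter⁺ Lines (x ∈?_) (∋-resp-≈ₗ x) (Finite.complete finiteLines l) (F∋x l∈F)

  -- The bound τ < ν₂ for systems with few lines.

  module TwoPoints {τ p q} (isτ : IsTransversalNumber τ) (q≉p : q ≉ₚ p) where

    missesBoth? : Decidable (λ l → p ∉ ⟦ l ⟧ × q ∉ ⟦ l ⟧)
    missesBoth? l = ¬? (p ∈? l) ×-dec ¬? (q ∈? l)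

    M = filter missesBoth? lines

    common = filter (λ l → (p ∈? l) ×-dec (q ∈? l)) lines

    ∣ℒ∣+∣common∣ : ∣ℒ∣ + length common ≡ deg p + deg q + length M
    ∣ℒ∣+∣common∣ = inclusion-exclusion (p ∈?_) (q ∈?_) lines

    M-misses : All (λ l → p ∉ ⟦ l ⟧ × q ∉ ⟦ l ⟧) M
    M-misses = all-filter missesBoth? lines

    missesBoth⇒∈M : ∀ {l} → p ∉ ⟦ l ⟧ → q ∉ ⟦ l ⟧ → l ∈ₗ M
    missesBoth⇒∈M {l} p∉l q∉l = ∈-filter⁺ Lines missesBoth?
      (λ l≈m (p∉ , q∉) → ∌-resp-≈ₗ p l≈m p∉ , ∌-resp-≈ₗ q l≈m q∉)
      (Finite.complete finiteLines l) (p∉l , q∉l)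

    ∈M⇒misses : ∀ {l} → l ∈ₗ M → p ∉ ⟦ l ⟧ × q ∉ ⟦ l ⟧
    ∈M⇒misses l∈M with (p∉m , q∉m) , (l⊆m , _) ← All.lookupAny M-misses l∈M = (p∉m ∘ l⊆m) , (q∉m ∘ l⊆m)

    -- A point can be chosen on every line because the transversal behind `isτ` meets every line.
    rep : Line → Point
    rep l = proj₁ (satisfied (isτ .proj₁ .proj₂ .proj₂ .proj₁ l))

    rep∈ : ∀ l → rep l ∈ ⟦ l ⟧
    rep∈ l = proj₂ (satisfied (isτ .proj₁ .proj₂ .proj₂ .proj₁ l))

    τ≤2+∣M∣ : τ ≤ 2 + length M
    τ≤2+∣M∣ = subst (λ k → τ ≤ 2 + k) (length-map rep M)
      (transversal⇒τ≤length isτ (p ∷ q ∷ map rep M) hits)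
      where
      hits : IsTransversal (p ∷ q ∷ map rep M)
      hits l with p ∈? l | q ∈? l
      ... | yes p∈l | _       = here p∈l
      ... | no  _   | yes q∈l = there (here q∈l)
      ... | no  p∉l | no  q∉l = there (there (representatives-hit rep∈ (missesBoth⇒∈M p∉l q∉l)))

    module _ (≤1-through : ∀ x → length (filter (x ∈?_) M) ≤ 1)
             {l lₚ l′ : Line}
             (p∈l : p ∈ ⟦ l ⟧) (q∈l : q ∈ ⟦ l ⟧)
             (p∈lₚ : p ∈ ⟦ lₚ ⟧) (q∉lₚ : q ∉ ⟦ lₚ ⟧)
             (p∉l′ : p ∉ ⟦ l′ ⟧) (q∈l′ : q ∈ ⟦ l′ ⟧)
             (lₚ∩l′∩M≡∅ : ∀ {x} → x ∈ ⟦ lₚ ⟧ → x ∈ ⟦ l′ ⟧ → ∀ {m} → m ∈ₗ M → x ∉ ⟦ m ⟧)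
             where

      -- By linearity `l` meets `lₚ` only in p and `l′` only in q, and no line of `M` passes through
      -- either point; p also avoids `l′` and q avoids `lₚ`. Points of `lₚ` and `l′` avoid `M` by
      -- assumption. Any other point is on at most one of the three new lines and at most one line
      -- of `M`.
      3+∣M∣≤ν₂ : ∀ {ν₂} → Is2PackingNumber ν₂ → 3 + length M ≤ ν₂
      3+∣M∣≤ν₂ (_ , maximal) = maximal R R! (twoThroughEachPoint⇒2Packing through)
        where
        R = l ∷ lₚ ∷ l′ ∷ M

        R! : Unique.Unique Lines R
        R! = (∈∧∉⇒≉ₗ {l = l} {lₚ} q∈l q∉lₚ ∷ ∈∧∉⇒≉ₗ {l = l} {l′} p∈l p∉l′
                ∷ All.map (λ {m} (p∉m , _) → ∈∧∉⇒≉ₗ {l = l} {m} p∈l p∉m) M-misses)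
           ∷ (∈∧∉⇒≉ₗ {l = lₚ} {l′} p∈lₚ p∉l′
                ∷ All.map (λ {m} (p∉m , _) → ∈∧∉⇒≉ₗ {l = lₚ} {m} p∈lₚ p∉m) M-misses)
           ∷ All.map (λ {m} (_ , q∉m) → ∈∧∉⇒≉ₗ {l = l′} {m} q∈l′ q∉m) M-misses
           ∷ Unique.filter⁺ Lines missesBoth? (Finite.unique finiteLines)

        l∩lₚ : ∀ {x} → x ∈ ⟦ l ⟧ → x ∈ ⟦ lₚ ⟧ → p ≈ₚ x
        l∩lₚ x∈l x∈lₚ = linear l lₚ (∈∧∉⇒≉ₗ {l = l} {lₚ} q∈l q∉lₚ) p _ p∈l p∈lₚ x∈l x∈lₚ

        l∩l′ : ∀ {x} → x ∈ ⟦ l ⟧ → x ∈ ⟦ l′ ⟧ → q ≈ₚ x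
        l∩l′ x∈l x∈l′ = linear l l′ (∈∧∉⇒≉ₗ {l = l} {l′} p∈l p∉l′) q _ q∈l q∈l′ x∈l x∈l′

        through : ∀ x → ∃[ F ] length F ≤ 2 × (∀ {k} → k ∈ₗ R → x ∈ ⟦ k ⟧ → k ∈ₗ F)
        through x with x ∈? l | x ∈? lₚ | x ∈? l′
        ... | yes x∈l | yes x∈lₚ | _ = l ∷ lₚ ∷ [] , ≤-refl , λ
          { (here e) _ → here e
          ; (there (here e)) _ → there (here e)
          ; (there (there (here e))) x∈k →
              contradiction (respects l′ (P.sym (l∩lₚ x∈l x∈lₚ)) (proj₁ e x∈k)) p∉l′
          ; {k} (there (there (there k∈M))) x∈k →
              contradiction (respects k (P.sym (l∩lₚ x∈l x∈lₚ)) x∈k) (proj₁ (∈M⇒misses k∈M)) }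
        ... | yes x∈l | no x∉lₚ | yes x∈l′ = l ∷ l′ ∷ [] , ≤-refl , λ
          { (here e) _ → here e
          ; (there (here e)) x∈k → contradiction (proj₁ e x∈k) x∉lₚ
          ; (there (there (here e))) x∈k → there (here e)
          ; {k} (there (there (there k∈M))) x∈k →
              contradiction (respects k (P.sym (l∩l′ x∈l x∈l′)) x∈k) (proj₂ (∈M⇒misses k∈M)) }
        ... | no x∉l | yes x∈lₚ | yes x∈l′ = lₚ ∷ l′ ∷ [] , ≤-refl , λ
          { (here e) x∈k → contradiction (proj₁ e x∈k) x∉l
          ; (there (here e)) x∈k → here e
          ; (there (there (here e))) x∈k → there (here e)
          ; {k} (there (there (there k∈M))) x∈k → contradiction x∈k (lₚ∩l′∩M≡∅ x∈lₚ x∈l′ k∈M) }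
        ... | yes x∈l | no x∉lₚ | no x∉l′ = l ∷ filter (x ∈?_) M , s≤s (≤1-through x) , λ
          { (here e) _ → here e
          ; (there (here e)) x∈k → contradiction (proj₁ e x∈k) x∉lₚ
          ; (there (there (here e))) x∈k → contradiction (proj₁ e x∈k) x∉l′
          ; (there (there (there k∈M))) x∈k → there (∈-filter⁺ Lines (x ∈?_) (∋-resp-≈ₗ x) k∈M x∈k) }
        ... | no x∉l | yes x∈lₚ | no x∉l′ = lₚ ∷ filter (x ∈?_) M , s≤s (≤1-through x) , λ
          { (here e) x∈k → contradiction (proj₁ e x∈k) x∉l
          ; (there (here e)) x∈k → here e
          ; (there (there (here e))) x∈k → contradiction (proj₁ e x∈k) x∉l′
          ; (there (there (there k∈M))) x∈k → there (∈-filter⁺ Lines (x ∈?_) (∋-resp-≈ₗ x) k∈M x∈k) }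
        -- The list may contain `l′` whether or not x lies on it, since only an upper bound is
        -- required.
        ... | no x∉l | no x∉lₚ | _ = l′ ∷ filter (x ∈?_) M , s≤s (≤1-through x) , λ
          { (here e) x∈k → contradiction (proj₁ e x∈k) x∉l
          ; (there (here e)) x∈k → contradiction (proj₁ e x∈k) x∉lₚ
          ; (there (there (here e))) x∈k → here e
          ; (there (there (there k∈M))) x∈k → there (∈-filter⁺ Lines (x ∈?_) (∋-resp-≈ₗ x) k∈M x∈k) }

    module LargeTransversals (large : 1 + length M < τ) where

      -- If x were on two lines of `M`, it could replace their two representatives: p, q, x and a
      -- point on each remaining line of `M` would be a transversal with at most |M| + 1 points.
      ≤1-through : ∀ x → length (filter (x ∈?_) M) ≤ 1
      ≤1-through x with length (filter (x ∈?_) M) ≤? 1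
      ... | yes ≤1 = ≤1
      ... | no ≰1 = contradiction (transversal⇒τ≤length isτ T hits) (<⇒≱ (≤-<-trans ∣T∣≤ large))
        where
        M∌x = filter (¬? ∘ (x ∈?_)) M
        T   = p ∷ q ∷ x ∷ map rep M∌x

        ∣T∣≤ : length T ≤ 1 + length M
        ∣T∣≤ = begin
          3 + length (map rep M∌x)                    ≡⟨ cong (3 +_) (length-map rep M∌x) ⟩
          1 + (2 + length M∌x)                        ≤⟨ +-monoʳ-≤ 1 (+-monoˡ-≤ _ (≰⇒> ≰1)) ⟩
          1 + (length (filter (x ∈?_) M) + length M∌x) ≡⟨ cong suc (length-filter-¬ (x ∈?_) M) ⟩
          1 + length M                                ∎
          where open ≤-Reasoning

        hits : IsTransversal T
        hits l with p ∈? l | q ∈? l | x ∈? l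
        ... | yes p∈l | _       | _       = here p∈l
        ... | no  _   | yes q∈l | _       = there (here q∈l)
        ... | no  _   | no  _   | yes x∈l = there (there (here x∈l))
        ... | no  p∉l | no  q∉l | no  x∉l = there (there (there (representatives-hit rep∈
              (∈-filter⁺ Lines (¬? ∘ (x ∈?_)) (∌-resp-≈ₗ x) (missesBoth⇒∈M p∉l q∉l) x∉l))))

      -- One point together with a point for each line of `M` makes |M| + 1 points, too few for a
      -- transversal. For x = q (or p) and `f` choosing points on their lines, the missed line is
      -- not in `M`, so it passes through the other of the two points.
      missed : ∀ x (f : Line → Point) → ∃[ l ] x ∉ ⟦ l ⟧ × All (λ y → y ∉ ⟦ l ⟧) (map f M)
      missed x f with short⇒misses isτ (x ∷ map f M)
                        (subst (λ k → 1 + k < τ) (≡.sym (length-map f M)) large)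
      ... | l , x∉l ∷ M∉l = l , x∉l , M∉l

      missed-∉M : ∀ {f} → (∀ l → f l ∈ ⟦ l ⟧) → ∀ {l} → All (λ y → y ∉ ⟦ l ⟧) (map f M) →
                  ¬ (p ∉ ⟦ l ⟧ × q ∉ ⟦ l ⟧)
      missed-∉M f∈ M∉l (p∉l , q∉l) =
        All¬⇒¬Any M∉l (representatives-hit f∈ (missesBoth⇒∈M p∉l q∉l))

      lₚ∃ : ∃[ l ] q ∉ ⟦ l ⟧ × p ∈ ⟦ l ⟧
      lₚ∃ with l , q∉l , M∉l ← missed q rep with p ∈? l
      ... | yes p∈l = l , q∉l , p∈l
      ... | no  p∉l = contradiction (p∉l , q∉l) (missed-∉M rep∈ M∉l)

      module _ {lₚ : Line} (p∈lₚ : p ∈ ⟦ lₚ ⟧) where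

        -- Whether `lₚ` and `m` meet is decidable: a common point is chosen if there is one, and the
        -- point `rep m` otherwise.
        repOn-lₚ : ∀ m → ∃[ x ] x ∈ ⟦ m ⟧ × (∀ y → y ∈ ⟦ lₚ ⟧ → y ∈ ⟦ m ⟧ → x ∈ ⟦ lₚ ⟧)
        repOn-lₚ m
          with Finite⇒∃? Points finitePoints {P = λ x → x ∈ ⟦ lₚ ⟧ × x ∈ ⟦ m ⟧}
                 (λ x≈y (x∈lₚ , x∈m) → respects lₚ x≈y x∈lₚ , respects m x≈y x∈m)
                 (λ x → (x ∈? lₚ) ×-dec (x ∈? m))
        ... | yes (x , x∈lₚ , x∈m) = x , x∈m , λ _ _ _ → x∈lₚ
        ... | no  ¬∃ = rep m , rep∈ m , λ y y∈lₚ y∈m → contradiction (y , y∈lₚ , y∈m) ¬∃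

        pick : Line → Point
        pick m = proj₁ (repOn-lₚ m)

        pick∈ : ∀ m → pick m ∈ ⟦ m ⟧
        pick∈ m = proj₁ (proj₂ (repOn-lₚ m))

        lq∃ : ∃[ l ] p ∉ ⟦ l ⟧ × q ∈ ⟦ l ⟧ × All (λ y → y ∉ ⟦ l ⟧) (map pick M)
        lq∃ with l , p∉l , M∉l ← missed p pick with q ∈? l
        ... | yes q∈l = l , p∉l , q∈l , M∉l
        ... | no  q∉l = contradiction (p∉l , q∉l) (missed-∉M pick∈ M∉l)

        -- If `lₚ` meets a line of `M` in x, the point picked on that line lies on `lₚ` too. As p
        -- separates the two lines, linearity makes it equal to x, yet `l′` misses every picked
        -- point.
        lₚ∩l′∩M≡∅ : ∀ {l′} → All (λ y → y ∉ ⟦ l′ ⟧) (map pick M) →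
          ∀ {x} → x ∈ ⟦ lₚ ⟧ → x ∈ ⟦ l′ ⟧ → ∀ {m} → m ∈ₗ M → x ∉ ⟦ m ⟧
        lₚ∩l′∩M≡∅ {l′} M∉l′ {x} x∈lₚ x∈l′ m∈M x∈m
          with (p∉m , fm∉l′) , (m⊆ , _) ← All.lookupAny (All.zip (All.map proj₁ M-misses , All.map⁻ M∉l′)) m∈M
          = fm∉l′ (respects l′ (linear lₚ _ (∈∧∉⇒≉ₗ {l = lₚ} {Any.lookup m∈M} p∈lₚ p∉m) x _
                     x∈lₚ (m⊆ x∈m) (proj₂ (proj₂ (repOn-lₚ _)) x x∈lₚ (m⊆ x∈m)) (pick∈ _)) x∈l′)

      M-extends : ∀ {ν₂} → Is2PackingNumber ν₂ → ∀ {l} → p ∈ ⟦ l ⟧ → q ∈ ⟦ l ⟧ → 3 + length M ≤ ν₂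
      M-extends isν₂ p∈l q∈l =
        let lₚ , q∉lₚ , p∈lₚ        = lₚ∃
            l′ , p∉l′ , q∈l′ , M∉l′ = lq∃ p∈lₚ
        in 3+∣M∣≤ν₂ ≤1-through p∈l q∈l p∈lₚ q∉lₚ p∉l′ q∈l′ (lₚ∩l′∩M≡∅ p∈lₚ M∉l′) isν₂

    -- By linearity, two distinct lines through both points would identify p and q.
    common≤1 : ∀ {l m ls} → All (λ l → p ∈ ⟦ l ⟧ × q ∈ ⟦ l ⟧) (l ∷ m ∷ ls) →
               ¬ Unique.Unique Lines (l ∷ m ∷ ls)
    common≤1 {l} {m} ((p∈l , q∈l) ∷ (p∈m , q∈m) ∷ _) ((l≉m ∷ _) ∷ _) =
      q≉p (linear l m l≉m q p q∈l q∈m p∈l p∈m)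

    τ<ν₂ : ∀ {ν₂} → Is2PackingNumber ν₂ → ∣ℒ∣ + 3 ≤ deg p + deg q + ν₂ → τ < ν₂
    τ<ν₂ {ν₂} isν₂ few = by-common common refl
      (all-filter common? lines) (Unique.filter⁺ Lines common? (Finite.unique finiteLines))
      where
      common? = λ l → (p ∈? l) ×-dec (q ∈? l)

      -- Adding |M| to both sides of `few` makes the right-hand side |ℒ| + |common| + ν₂ by
      -- inclusion-exclusion, and |ℒ| cancels.
      3+∣M∣≤ : 3 + length M ≤ length common + ν₂
      3+∣M∣≤ = +-cancelˡ-≤ ∣ℒ∣ _ _ (begin
        ∣ℒ∣ + (3 + length M)                ≡⟨ +-assoc ∣ℒ∣ 3 _ ⟨
        ∣ℒ∣ + 3 + length M                  ≤⟨ +-monoˡ-≤ _ few ⟩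
        deg p + deg q + ν₂ + length M       ≡⟨ +-assoc (deg p + deg q) ν₂ _ ⟩
        deg p + deg q + (ν₂ + length M)     ≡⟨ cong (deg p + deg q +_) (+-comm ν₂ _) ⟩
        deg p + deg q + (length M + ν₂)     ≡⟨ +-assoc (deg p + deg q) _ ν₂ ⟨
        deg p + deg q + length M + ν₂       ≡⟨ cong (_+ ν₂) ∣ℒ∣+∣common∣ ⟨
        ∣ℒ∣ + length common + ν₂            ≡⟨ +-assoc ∣ℒ∣ _ ν₂ ⟩
        ∣ℒ∣ + (length common + ν₂)          ∎)
        where open ≤-Reasoning

      by-common : ∀ ls → common ≡ ls → All (λ l → p ∈ ⟦ l ⟧ × q ∈ ⟦ l ⟧) ls → Unique.Unique Lines ls → τ < ν₂
      by-common [] common≡ _ _ =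
        ≤-trans (s≤s τ≤2+∣M∣) (subst (λ ls → 3 + length M ≤ length ls + ν₂) common≡ 3+∣M∣≤)
      -- A common line costs one unit: the count only gives |M| + 2 ≤ ν₂. That suffices when τ ≤ |M|
      -- + 1; otherwise the extended packing restores the missing unit.
      by-common (l ∷ []) common≡ ((p∈l , q∈l) ∷ []) _ with τ ≤? 1 + length M
      ... | yes τ≤ = ≤-trans (s≤s τ≤) (≤-pred (subst (λ ls → 3 + length M ≤ length ls + ν₂) common≡ 3+∣M∣≤))
      ... | no  τ≰ = ≤-trans (s≤s τ≤2+∣M∣) (LargeTransversals.M-extends (≰⇒> τ≰) isν₂ p∈l q∈l)
      by-common (_ ∷ _ ∷ _) _ both unique = contradiction unique (common≤1 both)

-- The system over Γ: non-neutral elements, incidence, equality of lines.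

module Construction (Γ : AbelianGroup c ℓ) (fin : Finite (AbelianGroup.setoid Γ))
                    (w : Setoid.Carrier (NonNeutral Γ)) where

  open AbelianGroup Γ renaming (refl to ≈-refl; sym to ≈-sym; trans to ≈-trans; setoid to Γₛ)
  open Group group using (_//_; _\\_)
  open Groupₚ group using (//-rightDividesˡ; \\-leftDividesˡ; \\-leftDividesʳ; ∙-cancelˡ; ∙-cancelʳ)
  open Membership Γₛ using () renaming (_∈_ to _∈Γ_)
  open SetSystem (𝒞 Γ)
  open Membership Lines using () renaming (_∈_ to _∈ₗ_)

  private
    _≟_ : Binary.Decidable _≈_
    _≟_ = Finite⇒≟ Γₛ fin

  ≉ε-resp : (_≉ ε) Respects _≈_
  ≉ε-resp g≈h g≉ε h≈ε = g≉ε (≈-trans g≈h h≈ε)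

  Γ∖ε : Finite (NonNeutral Γ)
  Γ∖ε = Finite-∃ Γₛ (λ g → ¬? (g ≟ ε)) ≉ε-resp fin

  n : ℕ
  n = Finite.size fin

  Γ∖ε-elements : List Carrier
  Γ∖ε-elements = map proj₁ (Finite.elements Γ∖ε)

  -- Putting `ε` back in front gives a second enumeration of Γ, from which both the number n - 1 and
  -- the sum of the non-neutral elements are read off.
  ε∷Γ∖ε : List Carrier
  ε∷Γ∖ε = ε ∷ Γ∖ε-elements

  proj₁≉ε : ∀ (gs : List (∃ (_≉ ε))) → All (_≉ ε) (map proj₁ gs)
  proj₁≉ε gs = All.map⁺ (All.universal proj₂ gs)

  ε∷Γ∖ε-unique : Unique.Unique Γₛ ε∷Γ∖ε
  ε∷Γ∖ε-unique = All.map (_∘ ≈-sym) (proj₁≉ε _)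
               ∷ Unique.map⁺ (NonNeutral Γ) Γₛ (λ g≈h → g≈h) (Finite.unique Γ∖ε)

  ∈ε∷Γ∖ε : ∀ g → g ∈Γ ε∷Γ∖ε
  ∈ε∷Γ∖ε g with g ≟ ε
  ... | yes g≈ε = here g≈ε
  ... | no  g≉ε = there (Any.map⁺ (Finite.complete Γ∖ε (g , g≉ε)))

  1+∣Γ∖ε-elements∣≡n : suc (length Γ∖ε-elements) ≡ n
  1+∣Γ∖ε-elements∣≡n = length≡size Γₛ fin ε∷Γ∖ε-unique ∈ε∷Γ∖ε

  1+∣Γ∖ε∣≡n : suc (Finite.size Γ∖ε) ≡ n
  1+∣Γ∖ε∣≡n = ≡.trans (cong suc (≡.sym (length-map proj₁ (Finite.elements Γ∖ε)))) 1+∣Γ∖ε-elements∣≡n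

  -- Membership in coordinates: the existential witnesses of `C⟦_⟧` are eliminated, so incidence
  -- with a grid point is a single equation in Γ, hence decidable and easy to transport.
  Incident : CLine Γ → Point → Set ℓ
  Incident (L g _) (inj₁ (h , y , _)) = y ≈ g
  Incident (L g _) (inj₂ _)           = ⊥
  Incident (lp g)  (inj₁ (h , y , _)) = h ≈ g
  Incident (lp g)  (inj₂ p)           = ⊤
  Incident (lp g)  (inj₂ q)           = ⊥
  Incident (lq g)  (inj₁ (h , y , _)) = y ≈ h ∙ g
  Incident (lq g)  (inj₂ p)           = ⊥
  Incident (lq g)  (inj₂ q)           = ⊤

  ∈⇒Incident : ∀ l x → x ∈ ⟦ l ⟧ → Incident l x
  ∈⇒Incident (L g _) (inj₁ _) (_ , inj₁ (_ , y≈g)) = y≈g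
  ∈⇒Incident (lp g)  (inj₁ _) (inj₁ (_ , _ , inj₁ (h≈g , _))) = h≈g
  ∈⇒Incident (lp g)  (inj₂ p) _ = tt
  ∈⇒Incident (lp g)  (inj₂ q) (inj₂ (inj₂ ()))
  ∈⇒Incident (lq g)  (inj₁ _) (inj₁ (_ , _ , inj₁ (h≈h′ , y≈h′∙g))) =
    ≈-trans y≈h′∙g (∙-congʳ (≈-sym h≈h′))
  ∈⇒Incident (lq g)  (inj₂ p) (inj₂ (inj₂ ()))
  ∈⇒Incident (lq g)  (inj₂ q) _ = tt

  Incident⇒∈ : ∀ l x → Incident l x → x ∈ ⟦ l ⟧
  Incident⇒∈ (L g _) (inj₁ (h , _))         y≈g   = h , inj₁ (≈-refl , y≈g)
  Incident⇒∈ (lp g)  (inj₁ (h , y , y≉ε))   h≈g   = inj₁ (y , y≉ε , inj₁ (h≈g , ≈-refl))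
  Incident⇒∈ (lp g)  (inj₂ p)               _     = inj₂ (inj₂ refl)
  Incident⇒∈ (lq g)  (inj₁ (h , y , y≉ε))   y≈h∙g = inj₁ (h , ≉ε-resp y≈h∙g y≉ε , inj₁ (≈-refl , y≈h∙g))
  Incident⇒∈ (lq g)  (inj₂ q)               _     = inj₂ (inj₂ refl)

  incident? : ∀ l x → Dec (Incident l x)
  incident? (L g _) (inj₁ (h , y , _)) = y ≟ g
  incident? (L g _) (inj₂ _)           = no λ ()
  incident? (lp g)  (inj₁ (h , y , _)) = h ≟ g
  incident? (lp g)  (inj₂ p)           = yes tt
  incident? (lp g)  (inj₂ q)           = no λ ()
  incident? (lq g)  (inj₁ (h , y , _)) = y ≟ (h ∙ g)
  incident? (lq g)  (inj₂ p)           = no λ ()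
  incident? (lq g)  (inj₂ q)           = yes tt

  Incident-resp : ∀ l {x y} → x ≈ₚ y → Incident l x → Incident l y
  Incident-resp (L g _) (inj₁ (_ , y≈y′))    y≈g   = ≈-trans (≈-sym y≈y′) y≈g
  Incident-resp (lp g)  (inj₁ (h≈h′ , _))    h≈g   = ≈-trans (≈-sym h≈h′) h≈g
  Incident-resp (lp g)  {inj₂ p} (inj₂ refl) _     = tt
  Incident-resp (lq g)  (inj₁ (h≈h′ , y≈y′)) y≈h∙g =
    ≈-trans (≈-sym y≈y′) (≈-trans y≈h∙g (∙-congʳ h≈h′))
  Incident-resp (lq g)  {inj₂ q} (inj₂ refl) _     = tt

  Incident⇒≈ₗ : ∀ l m → (∀ x → Incident l x → Incident m x) → (∀ x → Incident m x → Incident l x) → l ≈ₗ m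
  Incident⇒≈ₗ l m l⊆m m⊆l =
    (λ {x} x∈l → Incident⇒∈ m x (l⊆m x (∈⇒Incident l x x∈l))) ,
    (λ {x} x∈m → Incident⇒∈ l x (m⊆l x (∈⇒Incident m x x∈m)))

  ≈ₗ⇒Incident : ∀ {l m} → l ≈ₗ m → ∀ x → Incident l x → Incident m x
  ≈ₗ⇒Incident {l} {m} (l⊆m , _) x x∈l = ∈⇒Incident m x (l⊆m (Incident⇒∈ l x x∈l))

  ≈ₗ-sym : ∀ {l m} → l ≈ₗ m → m ≈ₗ l
  ≈ₗ-sym {l} {m} = Setoid.sym Lines {l} {m}

  L-cong : ∀ {g h g≉ε h≉ε} → g ≈ h → L g g≉ε ≈ₗ L h h≉ε
  L-cong g≈h = Incident⇒≈ₗ (L _ _) (L _ _)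
    (λ { (inj₁ _) y≈g → ≈-trans y≈g g≈h })
    (λ { (inj₁ _) y≈h → ≈-trans y≈h (≈-sym g≈h) })

  lp-cong : ∀ {g h} → g ≈ h → lp g ≈ₗ lp h
  lp-cong g≈h = Incident⇒≈ₗ (lp _) (lp _)
    (λ { (inj₁ _) x≈g → ≈-trans x≈g g≈h ; (inj₂ p) _ → tt })
    (λ { (inj₁ _) x≈h → ≈-trans x≈h (≈-sym g≈h) ; (inj₂ p) _ → tt })

  lq-cong : ∀ {g h} → g ≈ h → lq g ≈ₗ lq h
  lq-cong g≈h = Incident⇒≈ₗ (lq _) (lq _)
    (λ { (inj₁ _) y≈ → ≈-trans y≈ (∙-congˡ g≈h) ; (inj₂ q) _ → tt })
    (λ { (inj₁ _) y≈ → ≈-trans y≈ (∙-congˡ (≈-sym g≈h)) ; (inj₂ q) _ → tt })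

  L-injective : ∀ {g h g≉ε h≉ε} → L g g≉ε ≈ₗ L h h≉ε → g ≈ h
  L-injective {g} {h} {g≉ε} {h≉ε} e =
    ≈ₗ⇒Incident {L g g≉ε} {L h h≉ε} e (inj₁ (ε , g , g≉ε)) ≈-refl

  -- The symbol p does not distinguish these lines, so a grid point is needed; `w` supplies its
  -- non-neutral second coordinate.
  lp-injective : ∀ {g h} → lp g ≈ₗ lp h → g ≈ h
  lp-injective {g} {h} e = ≈ₗ⇒Incident {lp g} {lp h} e (inj₁ (g , w)) ≈-refl

  lq-injective : ∀ {g h} → lq g ≈ₗ lq h → g ≈ h
  lq-injective {g} {h} e = ∙-cancelˡ (w .proj₁ // g) g h
    (≈-trans (//-rightDividesˡ g (w .proj₁)) (≈ₗ⇒Incident {lq g} {lq h} e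
      (inj₁ (w .proj₁ // g , w)) (≈-sym (//-rightDividesˡ g (w .proj₁)))))

  -- Enumeration of the lines, and linearity.

  Codes : Setoid _ _
  Codes = NonNeutral Γ ⊎ₛ (Γₛ ⊎ₛ Γₛ)

  open Setoid Codes using () renaming (Carrier to Code; _≈_ to _≈꜀_)

  line : Code → CLine Γ
  line (inj₁ (g , g≉ε)) = L g g≉ε
  line (inj₂ (inj₁ g))  = lp g
  line (inj₂ (inj₂ g))  = lq g

  line-cong : ∀ {x y} → x ≈꜀ y → line x ≈ₗ line y
  line-cong (inj₁ g≈h)        = L-cong g≈h
  line-cong (inj₂ (inj₁ g≈h)) = lp-cong g≈h
  line-cong (inj₂ (inj₂ g≈h)) = lq-cong g≈h

  L≉lp : ∀ {g g≉ε h} → ¬ L g g≉ε ≈ₗ lp h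
  L≉lp {g} {g≉ε} {h} (_ , lp⊆L) with lp⊆L {inj₂ p} (inj₂ (inj₂ refl))
  ... | _ , ()

  L≉lq : ∀ {g g≉ε h} → ¬ L g g≉ε ≈ₗ lq h
  L≉lq {g} {g≉ε} {h} (_ , lq⊆L) with lq⊆L {inj₂ q} (inj₂ (inj₂ refl))
  ... | _ , ()

  lp≉lq : ∀ {g h} → ¬ lp g ≈ₗ lq h
  lp≉lq {g} {h} e with () ← ≈ₗ⇒Incident {lp g} {lq h} e (inj₂ p) tt

  -- Lines are compared as point sets, so the count (n - 1) + n + n is valid only because different
  -- codes give different sets. The symbols p and q separate the three families.
  line-injective : ∀ {x y} → line x ≈ₗ line y → x ≈꜀ y
  line-injective {inj₁ x}        {inj₁ y}        e = inj₁ (L-injective {x .proj₁} {y .proj₁} {x .proj₂} {y .proj₂} e)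
  line-injective {inj₁ x}        {inj₂ (inj₁ h)} e = contradiction e L≉lp
  line-injective {inj₁ x}        {inj₂ (inj₂ h)} e = contradiction e L≉lq
  line-injective {inj₂ (inj₁ g)} {inj₁ y}        e = contradiction (≈ₗ-sym {lp g} {L _ _} e) L≉lp
  line-injective {inj₂ (inj₁ g)} {inj₂ (inj₁ h)} e = inj₂ (inj₁ (lp-injective e))
  line-injective {inj₂ (inj₁ g)} {inj₂ (inj₂ h)} e = contradiction e lp≉lq
  line-injective {inj₂ (inj₂ g)} {inj₁ y}        e = contradiction (≈ₗ-sym {lq g} {L _ _} e) L≉lq
  line-injective {inj₂ (inj₂ g)} {inj₂ (inj₁ h)} e = contradiction (≈ₗ-sym {lq g} {lp h} e) lp≉lq
  line-injective {inj₂ (inj₂ g)} {inj₂ (inj₂ h)} e = inj₂ (inj₂ (lq-injective e))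

  line-surjective : ∀ l → ∃[ x ] line x ≈ₗ l
  line-surjective (L g g≉ε) = inj₁ (g , g≉ε)  , L-cong ≈-refl
  line-surjective (lp g)    = inj₂ (inj₁ g)   , lp-cong ≈-refl
  line-surjective (lq g)    = inj₂ (inj₂ g)   , lq-cong ≈-refl

  finiteCodes : Finite Codes
  finiteCodes = Finite-⊎ _ _ Γ∖ε (Finite-⊎ _ _ fin fin)

  finiteLines : Finite Lines
  finiteLines = Finite-map Codes Lines line line-cong line-injective line-surjective finiteCodes

  finiteSymbols : Finite (≡.setoid (Symbol Γ))
  finiteSymbols = record
    { elements = p ∷ q ∷ []
    ; unique   = ((λ ()) ∷ []) ∷ [] ∷ []
    ; complete = λ { p → here refl ; q → there (here refl) }
    }

  -- The families `L`, `lp` and `lq` fix the second coordinate, the first coordinate and their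
  -- difference, respectively. Any two of these values determine a grid point; this also governs the
  -- next two lemmas.
  L∩lp : ∀ {g g≉ε a} x y → Incident (L g g≉ε) x → Incident (lp a) x →
         Incident (L g g≉ε) y → Incident (lp a) y → x ≈ₚ y
  L∩lp (inj₁ _) (inj₁ _) y≈g x≈a y′≈g x′≈a =
    inj₁ (≈-trans x≈a (≈-sym x′≈a) , ≈-trans y≈g (≈-sym y′≈g))

  L∩lq : ∀ {g g≉ε a} x y → Incident (L g g≉ε) x → Incident (lq a) x →
         Incident (L g g≉ε) y → Incident (lq a) y → x ≈ₚ y
  L∩lq {a = a} (inj₁ (h , y , _)) (inj₁ (h′ , y′ , _)) y≈g y≈h∙a y′≈g y′≈h′∙a =
    inj₁ (∙-cancelʳ a h h′ (≈-trans (≈-sym y≈h∙a) (≈-trans y≈y′ y′≈h′∙a)) , y≈y′)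
    where y≈y′ = ≈-trans y≈g (≈-sym y′≈g)

  lp∩lq : ∀ {a b} x y → Incident (lp a) x → Incident (lq b) x →
          Incident (lp a) y → Incident (lq b) y → x ≈ₚ y
  lp∩lq (inj₁ _) (inj₁ _) h≈a y≈h∙b h′≈a y′≈h′∙b =
    inj₁ (h≈h′ , ≈-trans y≈h∙b (≈-trans (∙-congʳ h≈h′) (≈-sym y′≈h′∙b)))
    where h≈h′ = ≈-trans h≈a (≈-sym h′≈a)
  lp∩lq (inj₁ _) (inj₂ p) _ _ _ ()
  lp∩lq (inj₁ _) (inj₂ q) _ _ () _
  lp∩lq (inj₂ p) _ _ () _ _
  lp∩lq (inj₂ q) _ () _ _ _

  -- Within one family a shared grid point forces equal indices, so two distinct lines of that
  -- family can share at most p or q.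
  linear-Incident : ∀ l m → l ≉ₗ m → ∀ x y → Incident l x → Incident m x →
                    Incident l y → Incident m y → x ≈ₚ y
  linear-Incident (L g _) (L h _) l≉m (inj₁ _) _ y≈g y≈h _ _ =
    contradiction (L-cong (≈-trans (≈-sym y≈g) y≈h)) l≉m
  linear-Incident (L g _) (lp a)  _ x y x∈l x∈m y∈l y∈m = L∩lp {g} {_} {a} x y x∈l x∈m y∈l y∈m
  linear-Incident (L g _) (lq a)  _ x y x∈l x∈m y∈l y∈m = L∩lq {g} {_} {a} x y x∈l x∈m y∈l y∈m
  linear-Incident (lp a)  (L g _) _ x y x∈l x∈m y∈l y∈m = L∩lp {g} {_} {a} x y x∈m x∈l y∈m y∈l
  linear-Incident (lq a)  (L g _) _ x y x∈l x∈m y∈l y∈m = L∩lq {g} {_} {a} x y x∈m x∈l y∈m y∈l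
  linear-Incident (lp a)  (lq b)  _ x y x∈l x∈m y∈l y∈m = lp∩lq {a} {b} x y x∈l x∈m y∈l y∈m
  linear-Incident (lq b)  (lp a)  _ x y x∈l x∈m y∈l y∈m = lp∩lq {a} {b} x y x∈m x∈l y∈m y∈l
  linear-Incident (lp a)  (lp b)  l≉m (inj₁ _) _ h≈a h≈b _ _ =
    contradiction (lp-cong (≈-trans (≈-sym h≈a) h≈b)) l≉m
  linear-Incident (lp a)  (lp b)  l≉m (inj₂ p) (inj₁ _) _ _ h≈a h≈b =
    contradiction (lp-cong (≈-trans (≈-sym h≈a) h≈b)) l≉m
  linear-Incident (lp a)  (lp b)  l≉m (inj₂ p) (inj₂ p) _ _ _ _ = inj₂ refl
  linear-Incident (lq a)  (lq b)  l≉m (inj₁ (h , _)) _ y≈h∙a y≈h∙b _ _ =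
    contradiction (lq-cong (∙-cancelˡ h a b (≈-trans (≈-sym y≈h∙a) y≈h∙b))) l≉m
  linear-Incident (lq a)  (lq b)  l≉m (inj₂ q) (inj₁ (h , _)) _ _ y≈h∙a y≈h∙b =
    contradiction (lq-cong (∙-cancelˡ h a b (≈-trans (≈-sym y≈h∙a) y≈h∙b))) l≉m
  linear-Incident (lq a)  (lq b)  l≉m (inj₂ q) (inj₂ q) _ _ _ _ = inj₂ refl

  isLinearSystem : IsLinearSystem (𝒞 Γ)
  isLinearSystem = record
    { finitePoints = Finite-⊎ _ _ (Finite-× _ _ fin Γ∖ε) finiteSymbols
    ; finiteLines  = finiteLines
    ; respects     = λ l {x} {y} x≈y x∈l → Incident⇒∈ l y (Incident-resp l x≈y (∈⇒Incident l x x∈l))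
    ; _∈?_         = λ x l → map′ (Incident⇒∈ l x) (∈⇒Incident l x) (incident? l x)
    ; linear       = λ l m l≉m x y x∈l x∈m y∈l y∈m → linear-Incident l m l≉m x y
        (∈⇒Incident l x x∈l) (∈⇒Incident m x x∈m) (∈⇒Incident l y y∈l) (∈⇒Incident m y y∈m)
    }

  -- Sums in Γ and the transversal number.

  ∑-↭ : ∀ {xs ys} → Permutation._↭_ Γₛ xs ys → ∑ Γ xs ≈ ∑ Γ ys
  ∑-↭ = Permutationₚ.foldr-commMonoid Γₛ isCommutativeMonoid

  ∑-++ : ∀ xs ys → ∑ Γ (xs ++ ys) ≈ ∑ Γ xs ∙ ∑ Γ ys
  ∑-++ []       ys = ≈-sym (identityˡ (∑ Γ ys))
  ∑-++ (x ∷ xs) ys = ≈-trans (∙-congˡ (∑-++ xs ys)) (≈-sym (assoc x (∑ Γ xs) (∑ Γ ys)))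

  ∑-map-∙ : ∀ {A : Set d} {f g h : A → Carrier} → (∀ x → f x ≈ g x ∙ h x) →
            ∀ xs → ∑ Γ (map f xs) ≈ ∑ Γ (map g xs) ∙ ∑ Γ (map h xs)
  ∑-map-∙ f≈g∙h []       = ≈-sym (identityˡ ε)
  ∑-map-∙ f≈g∙h (x ∷ xs) = ≈-trans (∙-cong (f≈g∙h x) (∑-map-∙ f≈g∙h xs)) (interchange _ _ _ _)
    where open CommutativeSemigroupₚ commutativeSemigroup using (interchange)

  open LinearSystem (mkLinearSystem (𝒞 Γ) isLinearSystem)
    using (deg; ∣ℒ∣; IsTransversal; IsTransversalNumber; Is2Packing; Is2PackingNumber;
           HasMaxDegree; HasMaxDegreeApartFrom)

  ∈Γ∖ε⇒≉ε : ∀ {g} (gs : List (∃ (_≉ ε))) → g ∈Γ map proj₁ gs → g ≉ ε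
  ∈Γ∖ε⇒≉ε gs g∈gs with h≉ε , g≈h ← All.lookupAny (proj₁≉ε gs) g∈gs = ≉ε-resp (≈-sym g≈h) h≉ε

  Γ∖ε-elements-unique : Unique.Unique Γₛ Γ∖ε-elements
  Γ∖ε-elements-unique with _ ∷ unique ← ε∷Γ∖ε-unique = unique

  covering⇒n≤length : ∀ {xs} → (∀ g → g ∈Γ xs) → n ≤ length xs
  covering⇒n≤length covers = unique∧⊆⇒length-≤ Γₛ (Finite.unique fin) (λ {g} _ → covers g)

  module _ (∑≈ε : ∑ Γ (Finite.elements fin) ≈ ε) where

    -- With at most n entries nothing is repeated, so the list is a rearrangement of Γ.
    covering⇒∑≈ε : ∀ {xs} → (∀ g → g ∈Γ xs) → length xs ≤ n → ∑ Γ xs ≈ ε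
    covering⇒∑≈ε covers ∣xs∣≤n = ≈-trans
      (∑-↭ (unique∧⊆∧length-≥⇒↭ Γₛ (Finite.unique fin) (λ {g} _ → covers g) ∣xs∣≤n)) ∑≈ε

    ∑-Γ∖ε≈ε : ∑ Γ Γ∖ε-elements ≈ ε
    ∑-Γ∖ε≈ε = ≈-trans (≈-sym (identityˡ _)) (covering⇒∑≈ε ∈ε∷Γ∖ε (≤-reflexive 1+∣Γ∖ε-elements∣≡n))

    inner-transversal : (I : List (Carrier × ∃ (_≉ ε))) →
      (∀ g → g ∈Γ map proj₁ I) → (∀ g → g ∈Γ map (λ (h , y , _) → h \\ y) I) →
      (∀ g → g ≉ ε → g ∈Γ map (λ (_ , y , _) → y) I) → n < length I
    inner-transversal I fst-covers diff-covers snd-covers with n <? length I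
    ... | yes n<∣I∣ = n<∣I∣
    ... | no  n≮∣I∣ = Empty.⊥-elim (no-extra zs ys↭ ∑zs≈ε ∣I∣≡)
      where
      ys = map (λ (_ , y , _) → y) I

      extra = unique∧⊆⇒↭-++ Γₛ Γ∖ε-elements-unique
                (λ {g} g∈ → snd-covers g (∈Γ∖ε⇒≉ε (Finite.elements Γ∖ε) g∈))

      zs = proj₁ extra
      ys↭ = proj₂ extra

      n≤∣I∣ : n ≤ length I
      n≤∣I∣ = subst (n ≤_) (length-map proj₁ I) (covering⇒n≤length fst-covers)

      ∣map∣≤n : ∀ {A : Set d} (f : (Carrier × ∃ (_≉ ε)) → A) → length (map f I) ≤ n
      ∣map∣≤n f = subst (_≤ n) (≡.sym (length-map f I)) (≮⇒≥ n≮∣I∣)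

      ∑ys≈ε : ∑ Γ ys ≈ ε
      -- Each y is h plus the difference y - h, and both summands run through Γ exactly once.
      ∑ys≈ε = ≈-trans (∑-map-∙ (λ (h , y , _) → ≈-sym (\\-leftDividesˡ h y)) I)
        (≈-trans (∙-cong (covering⇒∑≈ε fst-covers (∣map∣≤n _)) (covering⇒∑≈ε diff-covers (∣map∣≤n _)))
          (identityˡ ε))

      ∑zs≈ε : ∑ Γ zs ≈ ε
      ∑zs≈ε = begin
        ∑ Γ zs                        ≈⟨ identityˡ _ ⟨
        ε ∙ ∑ Γ zs                    ≈⟨ ∙-congʳ ∑-Γ∖ε≈ε ⟨
        ∑ Γ Γ∖ε-elements ∙ ∑ Γ zs     ≈⟨ ∑-++ Γ∖ε-elements zs ⟨
        ∑ Γ (Γ∖ε-elements ++ zs)      ≈⟨ ∑-↭ ys↭ ⟨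
        ∑ Γ ys                        ≈⟨ ∑ys≈ε ⟩
        ε                             ∎
        where open import Relation.Binary.Reasoning.Setoid Γₛ

      ∣I∣≡ : length I ≡ length Γ∖ε-elements + length zs
      ∣I∣≡ = ≡.trans (≡.sym (length-map _ I))
               (≡.trans (Permutationₚ.xs↭ys⇒|xs|≡|ys| Γₛ ys↭) (length-++ Γ∖ε-elements))

      -- No leftover would give |I| = n - 1, and two or more would give |I| > n. A single leftover
      -- equals its sum `ε`, although it is the second coordinate of a grid point.
      no-extra : ∀ zs → Permutation._↭_ Γₛ ys (Γ∖ε-elements ++ zs) → ∑ Γ zs ≈ ε →
                  length I ≡ length Γ∖ε-elements + length zs → Empty.⊥
      no-extra [] _ _ ∣I∣≡ = <⇒≱ (≤-reflexive 1+∣Γ∖ε-elements∣≡n)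
        (subst (n ≤_) (≡.trans ∣I∣≡ (+-identityʳ _)) n≤∣I∣)
      no-extra (z ∷ []) ys↭ ∑≈ε _ = z≉ε (≈-trans (≈-sym (identityʳ z)) ∑≈ε)
        where
        z∈ys : z ∈Γ ys
        z∈ys = Permutationₚ.∈-resp-↭ Γₛ (Permutation.↭-sym Γₛ ys↭)
                 (∈-++⁺ʳ Γₛ Γ∖ε-elements (here ≈-refl))

        z≉ε : z ≉ ε
        z≉ε with y≉ε , z≈y ← All.lookupAny (All.map⁺ (All.universal (λ (_ , _ , y≉ε) → y≉ε) I)) z∈ys =
          ≉ε-resp (≈-sym z≈y) y≉ε
      no-extra (_ ∷ _ ∷ zs) _ _ ∣I∣≡ = n≮∣I∣ (begin
        suc n                                       ≡⟨ cong suc 1+∣Γ∖ε-elements∣≡n ⟨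
        2 + length Γ∖ε-elements                     ≡⟨ +-comm 2 _ ⟩
        length Γ∖ε-elements + 2                     ≤⟨ +-monoʳ-≤ (length Γ∖ε-elements) (s≤s (s≤s z≤n)) ⟩
        length Γ∖ε-elements + (2 + length zs)       ≡⟨ ∣I∣≡ ⟨
        length I                                    ∎)
        where open ≤-Reasoning

    -- Split by which symbols occur. With both, the lines `L` still require n - 1 grid points; with
    -- exactly one, the other pencil requires n of them; with neither, the sum argument requires n +
    -- 1.
    transversal⇒n+1≤length : ∀ T → IsTransversal T → n + 1 ≤ length T
    transversal⇒n+1≤length T T-transversal with partition-⊎ T
    ... | I , O , T↭ = subst (n + 1 ≤_) (≡.sym ∣T∣≡) (by-symbols (any? (p ≟ˢ_) O) (any? (q ≟ˢ_) O))
      where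
      _≟ˢ_ = Finite⇒≟ (≡.setoid (Symbol Γ)) finiteSymbols

      ∣T∣≡ : length T ≡ length I + length O
      ∣T∣≡ = ≡.trans (Perm≡ₚ.↭-length T↭) (≡.trans (length-++ (map inj₁ I))
               (cong₂ _+_ (length-map inj₁ I) (length-map inj₂ O)))

      hit : ∀ l → Any (Incident l ∘ inj₁) I ⊎ Any (Incident l ∘ inj₂) O
      hit l with Any.++⁻ (map inj₁ I) (Perm≡ₚ.Any-resp-↭ T↭ (Any.map (λ {x} → ∈⇒Incident l x) (T-transversal l)))
      ... | inj₁ hitI = inj₁ (Any.map⁻ hitI)
      ... | inj₂ hitO = inj₂ (Any.map⁻ hitO)

      snd-covers : ∀ g → g ≉ ε → g ∈Γ map (λ (_ , y , _) → y) I
      snd-covers g g≉ε with hit (L g g≉ε)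
      ... | inj₁ hitI = Any.map⁺ (Any.map ≈-sym hitI)
      ... | inj₂ hitO with () ← proj₂ (satisfied hitO)

      fst-covers : ¬ Any (p ≡_) O → ∀ g → g ∈Γ map proj₁ I
      fst-covers p∉O g with hit (lp g)
      ... | inj₁ hitI = Any.map⁺ (Any.map ≈-sym hitI)
      ... | inj₂ hitO = contradiction (Any.map (λ { {p} _ → refl }) hitO) p∉O

      diff-covers : ¬ Any (q ≡_) O → ∀ g → g ∈Γ map (λ (h , y , _) → h \\ y) I
      diff-covers q∉O g with hit (lq g)
      ... | inj₁ hitI = Any.map⁺ (Any.map
              (λ {x} y≈h∙g → ≈-sym (≈-trans (∙-congˡ y≈h∙g) (\\-leftDividesʳ (proj₁ x) g))) hitI)
      ... | inj₂ hitO = contradiction (Any.map (λ { {q} _ → refl }) hitO) q∉O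

      n≤∣I∣ : ∀ {f : (Carrier × ∃ (_≉ ε)) → Carrier} → (∀ g → g ∈Γ map f I) → n ≤ length I
      n≤∣I∣ {f} covers = subst (n ≤_) (length-map f I) (covering⇒n≤length covers)

      by-symbols : Dec (Any (p ≡_) O) → Dec (Any (q ≡_) O) → n + 1 ≤ length I + length O
      by-symbols (yes p∈O) (yes q∈O) = begin
        n + 1                              ≡⟨ cong (_+ 1) 1+∣Γ∖ε-elements∣≡n ⟨
        suc (length Γ∖ε-elements) + 1      ≡⟨ +-suc (length Γ∖ε-elements) 1 ⟨
        length Γ∖ε-elements + 2            ≤⟨ +-mono-≤ ∣Γ∖ε∣≤∣I∣ 2≤∣O∣ ⟩
        length I + length O                ∎
        where
        open ≤-Reasoning
        2≤∣O∣ : 2 ≤ length O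
        2≤∣O∣ = unique∧⊆⇒length-≤ (≡.setoid (Symbol Γ)) (Finite.unique finiteSymbols)
          λ { (here refl) → p∈O ; (there (here refl)) → q∈O }
        ∣Γ∖ε∣≤∣I∣ : length Γ∖ε-elements ≤ length I
        ∣Γ∖ε∣≤∣I∣ = subst (length Γ∖ε-elements ≤_) (length-map _ I)
          (unique∧⊆⇒length-≤ Γₛ Γ∖ε-elements-unique
            λ {g} g∈ → snd-covers g (∈Γ∖ε⇒≉ε (Finite.elements Γ∖ε) g∈))
      by-symbols (yes p∈O) (no q∉O) =
        +-mono-≤ (n≤∣I∣ (diff-covers q∉O)) (Membershipₚ.∈-length (≡.setoid (Symbol Γ)) p∈O)
      by-symbols (no p∉O) (yes q∈O) =
        +-mono-≤ (n≤∣I∣ (fst-covers p∉O)) (Membershipₚ.∈-length (≡.setoid (Symbol Γ)) q∈O)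
      by-symbols (no p∉O) (no q∉O) = ≤-trans (≤-reflexive (+-comm n 1))
        (m≤n⇒m≤n+o (length O) (inner-transversal I (fst-covers p∉O) (diff-covers q∉O) snd-covers))

    isTransversalNumber : IsTransversalNumber (n + 1)
    isTransversalNumber = (T , T-unique , T-transversal , ∣T∣≡n+1) , λ T _ → transversal⇒n+1≤length T
      where
      T : List Point
      -- The symbols meet both pencils, and one point on each `L` meets the rest; taking `ε` as
      -- first coordinate is an arbitrary choice.
      T = inj₂ p ∷ inj₂ q ∷ map (λ g → inj₁ (ε , g)) (Finite.elements Γ∖ε)

      T-unique : Unique.Unique Points T
      T-unique = ((λ { (inj₂ ()) }) ∷ All.map⁺ (All.universal (λ _ ()) _))
               ∷ All.map⁺ (All.universal (λ _ ()) _)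
               ∷ Unique.map⁺ (NonNeutral Γ) Points (λ { (inj₁ (_ , g≈h)) → g≈h }) (Finite.unique Γ∖ε)

      T-transversal : IsTransversal T
      T-transversal (L g g≉ε) = there (there (Any.map⁺ (Any.map
        (λ {x} g≈x → Incident⇒∈ (L g g≉ε) (inj₁ (ε , x)) (≈-sym g≈x)) (Finite.complete Γ∖ε (g , g≉ε)))))
      T-transversal (lp g)    = here (Incident⇒∈ (lp g) (inj₂ p) tt)
      T-transversal (lq g)    = there (here (Incident⇒∈ (lq g) (inj₂ q) tt))

      ∣T∣≡n+1 : length T ≡ n + 1
      ∣T∣≡n+1 = ≡.trans (cong (2 +_) (length-map _ (Finite.elements Γ∖ε)))
                  (≡.trans (cong suc 1+∣Γ∖ε∣≡n) (+-comm 1 n))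

  -- Degrees and the number of lines.

  degree-of-pencil : ∀ (f : Carrier → CLine Γ) x → (∀ {g h} → g ≈ h → f g ≈ₗ f h) →
    (∀ {g h} → f g ≈ₗ f h → g ≈ h) → (∀ g → x ∈ ⟦ f g ⟧) → (∀ l → Incident l x → ∃[ g ] l ≡ f g) →
    deg x ≡ n
  degree-of-pencil f x f-cong f-inj f∋x only-f = ≡.trans (≤-antisym
      (deg≤length 𝒮 x F through)
      (length≤deg 𝒮 x F (Unique.map⁺ Γₛ Lines f-inj (Finite.unique fin)) F∋x))
    (length-map f (Finite.elements fin))
    where
    𝒮 = mkLinearSystem (𝒞 Γ) isLinearSystem
    F = map f (Finite.elements fin)

    through : ∀ l → x ∈ ⟦ l ⟧ → l ∈ₗ F
    through l x∈l with only-f l (∈⇒Incident l x x∈l)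
    ... | g , refl = ∈-map⁺ Γₛ Lines f-cong (Finite.complete fin g)

    F∋x : ∀ {l} → l ∈ₗ F → x ∈ ⟦ l ⟧
    F∋x {l} l∈F with g , _ , (_ , fg⊆l) ← ∈-map⁻ Γₛ Lines {v = l} l∈F = fg⊆l (f∋x g)

  p∈lp : ∀ g → inj₂ p ∈ ⟦ lp g ⟧
  p∈lp g = Incident⇒∈ (lp g) (inj₂ p) tt

  q∈lq : ∀ g → inj₂ q ∈ ⟦ lq g ⟧
  q∈lq g = Incident⇒∈ (lq g) (inj₂ q) tt

  degree-p : deg (inj₂ p) ≡ n
  degree-p = degree-of-pencil lp (inj₂ p) lp-cong lp-injective p∈lp λ { (lp g) _ → g , refl }

  degree-q : deg (inj₂ q) ≡ n
  degree-q = degree-of-pencil lq (inj₂ q) lq-cong lq-injective q∈lq λ { (lq g) _ → g , refl }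

  -- A grid point lies on one line of each family, with indices its second coordinate, its first
  -- coordinate and their difference. For n at least 3 it therefore does not exceed the degree of p
  -- and q.
  degree-inner : ∀ x → deg (inj₁ x) ≤ 3
  degree-inner x@(h , y , y≉ε) = deg≤length (mkLinearSystem (𝒞 Γ) isLinearSystem) (inj₁ x)
    (L y y≉ε ∷ lp h ∷ lq (h \\ y) ∷ [])
    λ l x∈l → through l (∈⇒Incident l (inj₁ x) x∈l)
    where
    through : ∀ l → Incident l (inj₁ x) → l ∈ₗ L y y≉ε ∷ lp h ∷ lq (h \\ y) ∷ []
    through (L g _) y≈g   = here (L-cong (≈-sym y≈g))
    through (lp g)  h≈g   = there (here (lp-cong (≈-sym h≈g)))
    through (lq g)  y≈h∙g = there (there (here (lq-cong
      (≈-sym (≈-trans (∙-congˡ y≈h∙g) (\\-leftDividesʳ h g))))))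

  degree≤n : 3 ≤ n → ∀ x → deg x ≤ n
  degree≤n 3≤n (inj₁ x) = ≤-trans (degree-inner x) 3≤n
  degree≤n 3≤n (inj₂ p) = ≤-reflexive degree-p
  degree≤n 3≤n (inj₂ q) = ≤-reflexive degree-q

  p-maxDegree : 3 ≤ n → HasMaxDegree (inj₂ p)
  p-maxDegree 3≤n x = ≤-trans (degree≤n 3≤n x) (≤-reflexive (≡.sym degree-p))

  q-maxDegreeApartFrom-p : 3 ≤ n → HasMaxDegreeApartFrom (inj₂ p) (inj₂ q)
  q-maxDegreeApartFrom-p 3≤n =
    (λ { (inj₂ ()) }) , λ x _ → ≤-trans (degree≤n 3≤n x) (≤-reflexive (≡.sym degree-q))

  ∣ℒ∣+1≡3n : ∣ℒ∣ + 1 ≡ 3 * n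
  ∣ℒ∣+1≡3n = begin
    ∣ℒ∣ + 1                            ≡⟨ +-comm ∣ℒ∣ 1 ⟩
    suc ∣ℒ∣                            ≡⟨ cong suc (length-map line (Finite.elements finiteCodes)) ⟩
    suc (Finite.size finiteCodes)      ≡⟨ cong suc (size-⊎ _ _ Γ∖ε (Finite-⊎ _ _ fin fin)) ⟩
    suc (Finite.size Γ∖ε) + _          ≡⟨ cong₂ _+_ 1+∣Γ∖ε∣≡n (size-⊎ _ _ fin fin) ⟩
    n + (n + n)                        ≡⟨ cong (λ m → n + (n + m)) (+-identityʳ n) ⟨
    3 * n                              ∎
    where open ≡-Reasoning

  -- A 2-packing with n + 1 lines.

  packing-ε-w : List (CLine Γ)
  packing-ε-w = lp ε ∷ lp (w .proj₁) ∷ map (λ (g , g≉ε) → L g g≉ε) (Finite.elements Γ∖ε)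

  packing-ε-w-unique : Unique.Unique Lines packing-ε-w
  packing-ε-w-unique =
      ((λ e → w .proj₂ (≈-sym (lp-injective e)))
        ∷ All.map⁺ (All.universal (λ (g , g≉ε) e → L≉lp {g} {g≉ε} {ε} (≈ₗ-sym {lp ε} {L g g≉ε} e)) _))
    ∷ All.map⁺ (All.universal (λ (g , g≉ε) e → L≉lp {g} {g≉ε} {w .proj₁} (≈ₗ-sym {lp (w .proj₁)} {L g g≉ε} e)) _)
    ∷ Unique.map⁺ (NonNeutral Γ) Lines (λ {x} {y} → L-injective {x .proj₁} {y .proj₁} {x .proj₂} {y .proj₂})
        (Finite.unique Γ∖ε)

  -- The lines `L` are pairwise disjoint, and so are the two lines of the pencil at p apart from p
  -- itself. A grid point is thus on at most one line of each kind, p on the two pencil lines only,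
  -- and q on none.
  packing-ε-w-2Packing : Is2Packing packing-ε-w
  packing-ε-w-2Packing = twoThroughEachPoint⇒2Packing (mkLinearSystem (𝒞 Γ) isLinearSystem) through
    where
    ∉lq : ∀ {g} → ¬ lq g ∈ₗ packing-ε-w
    ∉lq {g} (here e) = lp≉lq (≈ₗ-sym {lq g} {lp ε} e)
    ∉lq {g} (there (here e)) = lp≉lq (≈ₗ-sym {lq g} {lp (w .proj₁)} e)
    ∉lq {g} (there (there lq∈)) with (h , h≉ε) , _ , e ← ∈-map⁻ (NonNeutral Γ) Lines {v = lq g} lq∈ =
      L≉lq (≈ₗ-sym {lq g} {L h h≉ε} e)

    throughInner : ∀ {h y y≉ε} l → Incident l (inj₁ (h , y , y≉ε)) → l ∈ₗ packing-ε-w → l ∈ₗ L y y≉ε ∷ lp h ∷ []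
    throughInner (L g _) y≈g _    = here (L-cong (≈-sym y≈g))
    throughInner (lp g)  h≈g _    = there (here (lp-cong (≈-sym h≈g)))
    throughInner (lq g)  _   lq∈  = contradiction lq∈ ∉lq

    throughp : ∀ l → Incident l (inj₂ p) → l ∈ₗ packing-ε-w → l ∈ₗ lp ε ∷ lp (w .proj₁) ∷ []
    throughp (lp g) _ (here e)                = here e
    throughp (lp g) _ (there (here e))        = there (here e)
    throughp (lp g) _ (there (there lp∈)) with (h , h≉ε) , _ , e ← ∈-map⁻ (NonNeutral Γ) Lines {v = lp g} lp∈ =
      contradiction (≈ₗ-sym {lp g} {L h h≉ε} e) L≉lp

    throughq : ∀ l → Incident l (inj₂ q) → l ∈ₗ packing-ε-w → l ∈ₗ []
    throughq (lq g) _ lq∈ = contradiction lq∈ ∉lq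

    through : ∀ x → ∃[ F ] length F ≤ 2 × (∀ {l} → l ∈ₗ packing-ε-w → x ∈ ⟦ l ⟧ → l ∈ₗ F)
    through x@(inj₁ (h , y , y≉ε)) = _ , ≤-refl , λ {l} l∈ x∈l → throughInner l (∈⇒Incident l x x∈l) l∈
    through (inj₂ p) = _ , ≤-refl , λ {l} l∈ x∈l → throughp l (∈⇒Incident l (inj₂ p) x∈l) l∈
    through (inj₂ q) = _ , z≤n    , λ {l} l∈ x∈l → throughq l (∈⇒Incident l (inj₂ q) x∈l) l∈

  ∣packing-ε-w∣≡n+1 : length packing-ε-w ≡ n + 1
  ∣packing-ε-w∣≡n+1 = ≡.trans (cong (2 +_) (length-map _ (Finite.elements Γ∖ε)))
                        (≡.trans (cong suc 1+∣Γ∖ε∣≡n) (+-comm 1 n))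

  -- The upper bound for 2-packings.

  module _ (g∙g≉ε : ∀ g → g ≉ ε → ¬ (g ∙ g ≈ ε)) where

    -- Adding the two equations and cancelling c + d leaves 2a = 2b, so 2(a - b) = e, which is
    -- excluded when a and b differ.
    double-injective : ∀ {a b c d} → a ∙ c ≈ b ∙ d → a ∙ d ≈ b ∙ c → ¬ ¬ a ≈ b
    double-injective {a} {b} {c} {d} ac≈bd ad≈bc a≉b = g∙g≉ε (a // b) (a≉b ∘ x∙y⁻¹≈ε⇒x≈y a b) (begin
      (a // b) ∙ (a // b)     ≈⟨ interchange a (b ⁻¹) a (b ⁻¹) ⟩
      (a ∙ a) ∙ (b ⁻¹ ∙ b ⁻¹) ≈⟨ ∙-congˡ (⁻¹-∙-comm b b) ⟩
      (a ∙ a) // (b ∙ b)      ≈⟨ x≈y⇒x∙y⁻¹≈ε aa≈bb ⟩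
      ε                       ∎)
      where
      open CommutativeSemigroupₚ commutativeSemigroup using (interchange)
      open AbelianGroupₚ Γ using (⁻¹-∙-comm)
      open Groupₚ group using (x∙y⁻¹≈ε⇒x≈y; x≈y⇒x∙y⁻¹≈ε)
      open import Relation.Binary.Reasoning.Setoid Γₛ

      aa≈bb : a ∙ a ≈ b ∙ b
      aa≈bb = ∙-cancelʳ (c ∙ d) (a ∙ a) (b ∙ b) (begin
        (a ∙ a) ∙ (c ∙ d)   ≈⟨ interchange a a c d ⟩
        (a ∙ c) ∙ (a ∙ d)   ≈⟨ ∙-cong ac≈bd ad≈bc ⟩
        (b ∙ d) ∙ (b ∙ c)   ≈⟨ interchange b d b c ⟩
        (b ∙ b) ∙ (d ∙ c)   ≈⟨ ∙-congˡ (comm d c) ⟩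
        (b ∙ b) ∙ (c ∙ d)   ∎)

    -- A weak |A + B| ≥ |A| + |B| − 1, where ε stands in for the sum when A or B is empty.
    sumset : ∀ {ℓ′} {Z : Pred Carrier ℓ′} A B → Unique.Unique Γₛ A → Unique.Unique Γₛ B →
             length A ≤ 2 → length B ≤ 2 → Z ε → (∀ {a b} → a ∈Γ A → b ∈Γ B → Z (a ∙ b)) →
             ∃[ F ] Unique.Unique Γₛ F × All Z F × length A + length B ≤ suc (length F)
    sumset [] B _ _ _ ∣B∣≤2 Zε _ = ε ∷ [] , [] ∷ [] , Zε ∷ [] , ∣B∣≤2
    sumset A@(_ ∷ _) [] _ _ ∣A∣≤2 _ Zε _ =
      ε ∷ [] , [] ∷ [] , Zε ∷ [] , ≤-trans (≤-reflexive (+-identityʳ (length A))) ∣A∣≤2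
    sumset (a ∷ []) (b ∷ []) _ _ _ _ Zε _ = ε ∷ [] , [] ∷ [] , Zε ∷ [] , ≤-refl
    sumset (a ∷ a′ ∷ []) (b ∷ []) ((a≉a′ ∷ []) ∷ _) _ _ _ _ Z∙ =
      a ∙ b ∷ a′ ∙ b ∷ [] ,
      ((a≉a′ ∘ ∙-cancelʳ b a a′) ∷ []) ∷ [] ∷ [] ,
      Z∙ (here ≈-refl) (here ≈-refl) ∷ Z∙ (there (here ≈-refl)) (here ≈-refl) ∷ [] , ≤-refl
    sumset (a ∷ []) (b ∷ b′ ∷ []) _ ((b≉b′ ∷ []) ∷ _) _ _ _ Z∙ =
      a ∙ b ∷ a ∙ b′ ∷ [] ,
      ((b≉b′ ∘ ∙-cancelˡ a b b′) ∷ []) ∷ [] ∷ [] ,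
      Z∙ (here ≈-refl) (here ≈-refl) ∷ Z∙ (here ≈-refl) (there (here ≈-refl)) ∷ [] , ≤-refl
    sumset (a ∷ a′ ∷ []) (b ∷ b′ ∷ []) ((a≉a′ ∷ []) ∷ _) ((b≉b′ ∷ []) ∷ _) _ _ _ Z∙
      -- Among the four sums only those of opposite corners can coincide, a + b with a′ + b′ or a +
      -- b′ with a′ + b. Both coincidences at once would contradict `double-injective`, so one
      -- opposite pair is distinct and yields three different sums.
      with (a ∙ b) ≟ (a′ ∙ b′)
    ... | no ab≉a′b′ =
      a ∙ b ∷ a ∙ b′ ∷ a′ ∙ b′ ∷ [] ,
      ((b≉b′ ∘ ∙-cancelˡ a b b′) ∷ ab≉a′b′ ∷ []) ∷ ((a≉a′ ∘ ∙-cancelʳ b′ a a′) ∷ []) ∷ [] ∷ [] ,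
      Z∙ (here ≈-refl) (here ≈-refl) ∷ Z∙ (here ≈-refl) (there (here ≈-refl))
        ∷ Z∙ (there (here ≈-refl)) (there (here ≈-refl)) ∷ [] , ≤-refl
    ... | yes ab≈a′b′ =
      a ∙ b′ ∷ a ∙ b ∷ a′ ∙ b ∷ [] ,
      ((b≉b′ ∘ ≈-sym ∘ ∙-cancelˡ a b′ b) ∷ (λ ab′≈a′b → double-injective ab≈a′b′ ab′≈a′b a≉a′) ∷ [])
        ∷ ((a≉a′ ∘ ∙-cancelʳ b a a′) ∷ []) ∷ [] ∷ [] ,
      Z∙ (here ≈-refl) (there (here ≈-refl)) ∷ Z∙ (here ≈-refl) (here ≈-refl)
        ∷ Z∙ (there (here ≈-refl)) (here ≈-refl) ∷ [] , ≤-refl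
    sumset (_ ∷ _ ∷ _ ∷ _) (_ ∷ _) _ _ (s≤s (s≤s ())) _ _ _
    sumset (_ ∷ _) (_ ∷ _ ∷ _ ∷ _) _ _ _ (s≤s (s≤s ())) _ _


    2Packing⇒pencil-length≤2 : ∀ {R} → Is2Packing R → ∀ (f : Carrier → CLine Γ) x →
      (∀ {g h} → f g ≈ₗ f h → g ≈ h) → (∀ g → x ∈ ⟦ f g ⟧) →
      ∀ A → Unique.Unique Γₛ A → (∀ {a} → a ∈Γ A → f a ∈ₗ R) → length A ≤ 2
    2Packing⇒pencil-length≤2 _ _ _ _ _ []           _ _ = z≤n
    2Packing⇒pencil-length≤2 _ _ _ _ _ (_ ∷ [])     _ _ = s≤s z≤n
    2Packing⇒pencil-length≤2 _ _ _ _ _ (_ ∷ _ ∷ []) _ _ = ≤-refl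
    2Packing⇒pencil-length≤2 packing f x f-inj f∋x (a ∷ b ∷ c ∷ _) ((a≉b ∷ a≉c ∷ _) ∷ (b≉c ∷ _) ∷ _) f∈R =
      contradiction (x , f∋x a , f∋x b , f∋x c)
        (packing (f a) (f b) (f c) (f∈R (here ≈-refl)) (f∈R (there (here ≈-refl)))
          (f∈R (there (there (here ≈-refl)))) (a≉b ∘ f-inj) (b≉c ∘ f-inj) (a≉c ∘ f-inj))

    open Permutation Lines using () renaming (_↭_ to _↭ₗ_)

    L′ : ∃ (_≉ ε) → CLine Γ
    L′ (g , g≉ε) = L g g≉ε

    partition-lines : ∀ R → ∃[ Ls ] ∃[ Ps ] ∃[ Qs ] R ↭ₗ map L′ Ls ++ (map lp Ps ++ map lq Qs)
    partition-lines [] = [] , [] , [] , ↭-refl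
      where open Permutation Lines
    partition-lines (L g g≉ε ∷ R) with Ls , Ps , Qs , R↭ ← partition-lines R =
      (g , g≉ε) ∷ Ls , Ps , Qs , ↭-prep (L g g≉ε) R↭
      where open Permutation Lines
    partition-lines (lp g ∷ R) with Ls , Ps , Qs , R↭ ← partition-lines R =
      Ls , g ∷ Ps , Qs , ↭-trans (↭-prep (lp g) R↭)
        (↭-sym (Permutationₚ.↭-shift Lines (map L′ Ls) (map lp Ps ++ map lq Qs)))
      where open Permutation Lines
    partition-lines (lq g ∷ R) with Ls , Ps , Qs , R↭ ← partition-lines R =
      Ls , Ps , g ∷ Qs , ↭-trans (↭-prep (lq g) R↭) (↭-sym (↭-trans
        (Permutationₚ.++⁺ˡ Lines (map L′ Ls) (Permutationₚ.↭-shift Lines (map lp Ps) (map lq Qs)))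
        (Permutationₚ.↭-shift Lines (map L′ Ls) (map lp Ps ++ map lq Qs))))
      where open Permutation Lines

    -- The set `F` of excluded indices is disjoint from the indices of the lines `L` in the packing,
    -- so together they number at most n. The pencil lines number at most |F| + 1.
    2Packing⇒length≤n+1 : ∀ R → Unique.Unique Lines R → Is2Packing R → length R ≤ n + 1
    2Packing⇒length≤n+1 R R! R-packing with partition-lines R
    ... | Ls , Ps , Qs , R↭ = begin
      length R                                ≡⟨ ∣R∣≡ ⟩
      length Ls + (length Ps + length Qs)     ≤⟨ +-monoʳ-≤ (length Ls) ∣Ps∣+∣Qs∣≤ ⟩
      length Ls + suc (length F)              ≡⟨ +-suc (length Ls) (length F) ⟩
      suc (length Ls + length F)              ≡⟨ cong suc (+-comm (length Ls) (length F)) ⟩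
      suc (length F + length Ls)              ≤⟨ s≤s ∣F∣+∣Ls∣≤n ⟩
      suc n                                   ≡⟨ +-comm 1 n ⟩
      n + 1                                   ∎
      where
      open ≤-Reasoning
      gs = map proj₁ Ls

      ∣R∣≡ : length R ≡ length Ls + (length Ps + length Qs)
      ∣R∣≡ = ≡.trans (Permutationₚ.xs↭ys⇒|xs|≡|ys| Lines R↭)
        (≡.trans (length-++ (map L′ Ls)) (cong₂ _+_ (length-map L′ Ls)
          (≡.trans (length-++ (map lp Ps)) (cong₂ _+_ (length-map lp Ps) (length-map lq Qs)))))

      ∈R : ∀ {l} → l ∈ₗ map L′ Ls ++ (map lp Ps ++ map lq Qs) → l ∈ₗ R
      ∈R {l} = Permutationₚ.∈-resp-↭ Lines {l} (Permutation.↭-sym Lines R↭)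

      L∈R : ∀ {g} g≉ε → g ∈Γ gs → L g g≉ε ∈ₗ R
      L∈R {g} g≉ε g∈gs = ∈R {L g g≉ε} (∈-++⁺ˡ Lines {v = L g g≉ε} (Any.map⁺ (Any.map L-cong (Any.map⁻ g∈gs))))

      lp∈R : ∀ {a} → a ∈Γ Ps → lp a ∈ₗ R
      lp∈R {a} a∈Ps = ∈R {lp a}
        (∈-++⁺ʳ Lines {v = lp a} (map L′ Ls) (∈-++⁺ˡ Lines {v = lp a} (∈-map⁺ Γₛ Lines lp-cong a∈Ps)))

      lq∈R : ∀ {b} → b ∈Γ Qs → lq b ∈ₗ R
      lq∈R {b} b∈Qs = ∈R {lq b}
        (∈-++⁺ʳ Lines {v = lq b} (map L′ Ls) (∈-++⁺ʳ Lines {v = lq b} (map lp Ps) (∈-map⁺ Γₛ Lines lq-cong b∈Qs)))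

      parts! = Unique-++⁻ Lines (map L′ Ls) (Permutationₚ.Unique-resp-↭ Lines R↭ R!)
      parts!′ = Unique-++⁻ Lines (map lp Ps) (proj₂ parts!)

      gs! : Unique.Unique Γₛ gs
      gs! = Unique.map⁺ (NonNeutral Γ) Γₛ (λ g≈h → g≈h)
              (Unique.map⁻ (NonNeutral Γ) Lines {f = L′} L-cong (proj₁ parts!))

      Ps! : Unique.Unique Γₛ Ps
      Ps! = Unique.map⁻ Γₛ Lines lp-cong (proj₁ parts!′)

      Qs! : Unique.Unique Γₛ Qs
      Qs! = Unique.map⁻ Γₛ Lines lq-cong (proj₂ parts!′)

      -- Otherwise the grid point (a, a + b) would be on three lines of the packing.
      sum∉gs : ∀ {a b} → a ∈Γ Ps → b ∈Γ Qs → ¬ (a ∙ b) ∈Γ gs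
      sum∉gs {a} {b} a∈Ps b∈Qs a∙b∈gs =
        R-packing (L (a ∙ b) a∙b≉ε) (lp a) (lq b) (L∈R a∙b≉ε a∙b∈gs) (lp∈R a∈Ps) (lq∈R b∈Qs)
          L≉lp lp≉lq L≉lq
          (x , Incident⇒∈ (L (a ∙ b) a∙b≉ε) x ≈-refl , Incident⇒∈ (lp a) x ≈-refl , Incident⇒∈ (lq b) x ≈-refl)
        where
        a∙b≉ε = ∈Γ∖ε⇒≉ε Ls a∙b∈gs
        x : Point
        x = inj₁ (a , a ∙ b , a∙b≉ε)

      sums = sumset {Z = λ g → ¬ g ∈Γ gs} Ps Qs Ps! Qs!
        (2Packing⇒pencil-length≤2 R-packing lp (inj₂ p) lp-injective p∈lp Ps Ps! lp∈R)
        (2Packing⇒pencil-length≤2 R-packing lq (inj₂ q) lq-injective q∈lq Qs Qs! lq∈R)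
        -- The neutral element indexes no line `L`, so it is an excluded value even when a pencil
        -- contributes no line.
        (λ ε∈gs → ∈Γ∖ε⇒≉ε Ls ε∈gs ≈-refl) sum∉gs

      F           = proj₁ sums
      F!          = proj₁ (proj₂ sums)
      F∉gs        = proj₁ (proj₂ (proj₂ sums))
      ∣Ps∣+∣Qs∣≤  = proj₂ (proj₂ (proj₂ sums))

      ∣F∣+∣Ls∣≤n : length F + length Ls ≤ n
      ∣F∣+∣Ls∣≤n = subst (_≤ n)
        (≡.trans (length-++ F) (cong (length F +_) (length-map proj₁ Ls)))
        (unique∧⊆⇒length-≤ Γₛ
          (Unique.++⁺ Γₛ F! gs! λ (v∈F , v∈gs) →
            let f∉gs , v≈f = All.lookupAny F∉gs v∈F in f∉gs (Membershipₚ.∈-resp-≈ Γₛ v≈f v∈gs))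
          (λ {g} _ → Finite.complete fin g))

    is2PackingNumber : Is2PackingNumber (n + 1)
    is2PackingNumber =
      (packing-ε-w , packing-ε-w-unique , packing-ε-w-2Packing , ∣packing-ε-w∣≡n+1) , 2Packing⇒length≤n+1

    -- Comparison with the explicit packing gives uniqueness of the maximum, for use in the line
    -- count, which speaks of an arbitrary value of ν₂.
    2PackingNumber≡n+1 : ∀ {ν₂} → Is2PackingNumber ν₂ → ν₂ ≡ n + 1
    2PackingNumber≡n+1 ((R , R! , R-packing , refl) , maximal) = ≤-antisym
      (2Packing⇒length≤n+1 R R! R-packing)
      (subst (_≤ length R) ∣packing-ε-w∣≡n+1 (maximal packing-ε-w packing-ε-w-unique packing-ε-w-2Packing))

    ∣ℒ∣+2≡degrees+ν₂ : ∀ {ν₂} → Is2PackingNumber ν₂ → ∣ℒ∣ + 2 ≡ deg (inj₂ p) + deg (inj₂ q) + ν₂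
    ∣ℒ∣+2≡degrees+ν₂ {ν₂} isν₂ = begin
      ∣ℒ∣ + 2                            ≡⟨ +-assoc ∣ℒ∣ 1 1 ⟨
      ∣ℒ∣ + 1 + 1                        ≡⟨ cong (_+ 1) ∣ℒ∣+1≡3n ⟩
      n + (n + (n + 0)) + 1              ≡⟨ cong (λ m → n + (n + m) + 1) (+-identityʳ n) ⟩
      n + (n + n) + 1                    ≡⟨ cong (_+ 1) (+-assoc n n n) ⟨
      n + n + n + 1                      ≡⟨ +-assoc (n + n) n 1 ⟩
      n + n + (n + 1)                    ≡⟨ cong₂ _+_ (cong₂ _+_ degree-p degree-q) (2PackingNumber≡n+1 isν₂) ⟨
      deg (inj₂ p) + deg (inj₂ q) + ν₂   ∎
      where open ≡-Reasoning

theorem3p2 : ∀ {c ℓ a b i r : Level} (n k : ℕ) → n ≡ 2 * k + 1 → 1 ≤ k →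
    (Γ : AbelianGroup c ℓ) (finite : Finite (AbelianGroup.setoid Γ)) →
    let open AbelianGroup Γ in
    Finite.size finite ≡ n →
    ∑ Γ (Finite.elements finite) ≈ ε →
    (∀ g → g ≉ ε → ¬ (g ∙ g ≈ ε)) →
    (Σ[ isLinear ∈ IsLinearSystem (𝒞 Γ) ]
    let open LinearSystem (mkLinearSystem (𝒞 Γ) isLinear) in
    IsTransversalNumber (n + 1) ×
    Is2PackingNumber (n + 1) ×
    HasMaxDegree (inj₂ p) ×
    HasMaxDegreeApartFrom (inj₂ p) (inj₂ q) ×
    deg (inj₂ p) ≡ n ×
    deg (inj₂ q) ≡ n ×
    ∣ℒ∣ + 1 ≡ 3 * n ×
    (∀ ν₂ → Is2PackingNumber ν₂ →
    ∣ℒ∣ + 2 ≡ deg (inj₂ p) + deg (inj₂ q) + ν₂)) ×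
    ((S : LinearSystem a b i r) →
    let open LinearSystem S in
    ∀ ν₂ p′ q′ →
    Is2PackingNumber ν₂ →
    ν₂ < ∣ℒ∣ →
    HasMaxDegree p′ →
    HasMaxDegreeApartFrom p′ q′ →
    ∣ℒ∣ + 3 ≤ deg p′ + deg q′ + ν₂ →
    ∀ τ → IsTransversalNumber τ → τ + 1 ≤ ν₂)
theorem3p2 n k n≡2k+1 1≤k Γ finite refl ∑≈ε g∙g≉ε =
  ( isLinearSystem
  , isTransversalNumber ∑≈ε
  , is2PackingNumber g∙g≉ε
  , p-maxDegree 3≤n
  , q-maxDegreeApartFrom-p 3≤n
  , degree-p
  , degree-q
  , ∣ℒ∣+1≡3n
  , λ _ → ∣ℒ∣+2≡degrees+ν₂ g∙g≉ε
  ) ,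
  λ S ν₂ p′ q′ isν₂ _ _ (q′≉p′ , _) few τ isτ →
    subst (_≤ ν₂) (+-comm 1 τ) (TwoPoints.τ<ν₂ S isτ q′≉p′ isν₂ few)
  where
  -- From k ≥ 1. It provides the non-neutral element for the construction and makes the degree bound
  -- 3 of grid points at most n.
  3≤n : 3 ≤ n
  3≤n = subst (3 ≤_) (≡.sym n≡2k+1) (+-monoˡ-≤ 1 (*-monoʳ-≤ 2 1≤k))

  open Construction Γ finite
    (2≤size⇒∃≉ (AbelianGroup.setoid Γ) finite (≤-trans (n≤1+n 2) 3≤n) (AbelianGroup.ε Γ))
    hiding (n)
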